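{- Let $\mathcal{G}$ be a game model over a state space $S$ which is closed under the Souslin operation. For each formula $\varphi$ of game logic, the maps $$P_{\varphi?}(s):=\{W\in\mathcal{B}(\mathrm{Sub}(S))\mid F_{[\![\varphi]\!]_{\mathcal{G}}}^{ -1}[W]\in I_D(s)\},\qquad P_{\varphi\text{¿}}(s):=\{W\in\mathcal{B}(\mathrm{Sub}(S))\mid F_{S\setminus[\![\varphi]\!]_{\mathcal{G}}}^{ -1}[W]\in I_D(s)\}$$ ($s\in S$) are stochastic effectivity functions on $S$.
   Context: A measurable space $S$ has a $\sigma$-algebra $\mathcal{B}(S)$; $[0,1]$ carries its Borel sets; $S\otimes T$ is the product space. $\mathrm{Sub}(S)$ is the set of subprobability measures on $S$ with the smallest $\sigma$-algebra making all $\mu\mapsto\mu(A)$, $A\in\mathcal{B}(S)$, measurable. $\boldsymbol\beta(A,>q):=\{\mu\in\mathrm{Sub}(S)\mid\mu(A)>q\}$. $\mathcal{V}(S)$ is the set of all upward closed $V\subseteq\mathcal{B}(\mathrm{Sub}(S))$. $P:S\to\mathcal{V}(S)$ is t-measurable iff $\{\langle s,q\rangle\in S\times[0,1]\mid H_q\in P(s)\}\in\mathcal{B}(S\otimes[0,1])$ for every $H\in\mathcal{B}(\mathrm{Sub}(S)\otimes[0,1])$, where $H_q:=\{\mu\mid\langle\mu,q\rangle\in H\}$; a stochastic effectivity function on $S$ is a t-measurable map $S\to\mathcal{V}(S)$. The Dirac effectivity function is $I_D(s):=\{W\in\mathcal{B}(\mathrm{Sub}(S))\mid\delta_s\in W\}$.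 For $A\in\mathcal{B}(S)$, $F_A:\mathrm{Sub}(S)\to\mathrm{Sub}(S)$ is given by $F_A(\mu)(B):=\mu(A\cap B)$. $S$ is closed under the Souslin operation iff $\bigcup_{\alpha\in\mathbb{N}^{\mathbb{N}}}\bigcap_{n\in\mathbb{N}}A_{\alpha|n}\in\mathcal{B}(S)$ for every family $(A_v)$ in $\mathcal{B}(S)$ indexed by finite words $v$ over $\mathbb{N}$ ($\alpha|n$ = first $n$ letters of $\alpha$). Games: $\Gamma$ is the set of primitive games, containing the empty game $\epsilon$. Games: $\tau::=\gamma\mid\tau^d\mid\tau_1\cup\tau_2\mid\tau_1\cap\tau_2\mid\tau_1;\tau_2\mid\tau^*\mid\tau^\times$, $\gamma\in\Gamma$, identified according to: $(\tau^d)^d=\tau$; $\tau_1\cap\tau_2=(\tau_1^d\cup\tau_2^d)^d$; $(\tau^\times)^d=(\tau^d)^*$; $(\tau_1\cup\tau_2);\tau=\tau_1;\tau\cup\tau_2;\tau$; $(\tau_1;\tau_2)^d=\tau_1^d;\tau_2^d$; $\cup,\cap$ commutative and associative, $;$ associative; $\tau^*;\tau_0$ expands to $\tau_0\cup\tau;\tau_0\cup\tau;\tau;\tau_0\cup\dots$. A game frame $(S,(P_\gamma)_{\gamma\in\Gamma})$ has a measurable space $S$ and stochastic effectivity functions $P_\gamma$ on $S$, with $P_\epsilon=I_D$. With $Q^{(k)}(q):=\{\langle a_1,\dots,a_k\rangle\in\mathbb{Q}^k\mid a_i\geq0,\sum_ia_i\leq q\}$ ($0\leq k\leq\infty$), for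 $A\in\mathcal{B}(S)$, $q\geq0$ define recursively, modulo the identifications: (A) $\mathfrak{I}_{\mathcal{G}}(\gamma\mid A,q):=\{s\mid\boldsymbol\beta(A,>q)\in P_\gamma(s)\}$, $\gamma\in\Gamma$; (B) $\mathfrak{I}_{\mathcal{G}}(\tau^d\mid A,q):=S\setminus\mathfrak{I}_{\mathcal{G}}(\tau\mid S\setminus A,q)$; (C) $\mathfrak{I}_{\mathcal{G}}(\tau_1\cup\tau_2\mid A,q):=\bigcap_{a\in Q^{(2)}(q)}(\mathfrak{I}_{\mathcal{G}}(\tau_1\mid A,a_1)\cup\mathfrak{I}_{\mathcal{G}}(\tau_2\mid A,a_2))$; (D) $\mathfrak{I}_{\mathcal{G}}((\tau_1\cup\tau_2);\tau\mid A,q):=\mathfrak{I}_{\mathcal{G}}(\tau_1;\tau\cup\tau_2;\tau\mid A,q)$; (E) $\mathfrak{I}_{\mathcal{G}}(\gamma;\tau\mid A,q):=\{s\mid G_\tau(A,q)\in P_\gamma(s)\}$, $\gamma\in\Gamma$, with $G_\tau(A,q):=\{\mu\in\mathrm{Sub}(S)\mid\int_0^1\mu(\mathfrak{I}_{\mathcal{G}}(\tau\mid A,r))\,dr>q\}$; (F) $\mathfrak{I}_{\mathcal{G}}(\tau^*;\tau_0\mid A,q):=\bigcap_{a\in Q^{(\infty)}(q)}\bigcup_{n\geq0}\mathfrak{I}_{\mathcal{G}}(\tau^n;\tau_0\mid A,a_{n+1})$, with $\tau^n=\tau;\dots;\tau$ ($n$ times), $\tau^0;\tau_0=\tau_0$;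 bare $\tau^*$ is read as $\tau^*;\epsilon$. Game logic: formulas $\varphi::=\top\mid p\mid\varphi_1\wedge\varphi_2\mid\langle\tau\rangle_q\varphi$ with $p\in\Psi$ atomic propositions, $\tau$ a game, $q\in[0,1]$. A game model $\mathcal{G}=(S,(P_\gamma)_{\gamma\in\Gamma},(V_p)_{p\in\Psi})$ is a game frame together with sets $V_p\in\mathcal{B}(S)$. Validity sets: $[\![\top]\!]_{\mathcal{G}}=S$, $[\![p]\!]_{\mathcal{G}}=V_p$, $[\![\varphi_1\wedge\varphi_2]\!]_{\mathcal{G}}=[\![\varphi_1]\!]_{\mathcal{G}}\cap[\![\varphi_2]\!]_{\mathcal{G}}$, $[\![\langle\tau\rangle_q\varphi]\!]_{\mathcal{G}}=\mathfrak{I}_{\mathcal{G}}(\tau\mid[\![\varphi]\!]_{\mathcal{G}},q)$. -}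

module Defs where

open import Axiom.ExcludedMiddle using (ExcludedMiddle)
open import Data.Bool.Base using (Bool; true; false; not; _∧_; _∨_; if_then_else_)
open import Data.Empty using (⊥-elim)
open import Data.Integer.Base as ℤ using (+_)
import Data.Integer.Properties as ℤP
open import Data.List.Base using (List; applyUpTo)
open import Data.Nat.Base as ℕ using (ℕ; zero; suc)
open import Data.Nat.GeneralisedArithmetic using (fold)
import Data.Nat.Properties as ℕP
open import Data.Product.Base using (Σ; Σ-syntax; ∃-syntax; _×_; _,_; proj₁; proj₂)
open import Data.Rational.Base as ℚ using (ℚ; 0ℚ; 1ℚ)
import Data.Rational.Properties as ℚP
import Data.Rational.Unnormalised.Base as ℚᵘ
import Data.Rational.Unnormalised.Properties as ℚᵘP
open import Data.Rational.Solver using (module +-*-Solver)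
open import Function.Base using (_∘_)
open import Function.Bundles using (_⇔_)
open import Level using (0ℓ)
open import Relation.Binary.Definitions using (tri<; tri≈; tri>)
open import Relation.Binary.PropositionalEquality
  using (_≡_; _≢_; refl; sym; trans; cong; subst; subst₂)
open import Relation.Nullary using (¬_; Dec; does; yes; no)

-- Games over the primitive games Γ, before any identification; the
-- identifications enter through the interpretation 𝔍 below.

infixr 6 _⊍_
infixr 7 _⩀_
infixr 8 _；_
infix  9 _ᵈ _* _ˣ

data Game (Γ : Set) : Set where
  prim : Γ → Game Γ
  _ᵈ   : Game Γ → Game Γ
  _⊍_  : Game Γ → Game Γ → Game Γ
  _⩀_  : Game Γ → Game Γ → Game Γ
  _；_ : Game Γ → Game Γ → Game Γ
  _*   : Game Γ → Game Γ
  _ˣ   : Game Γ → Game Γ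

sumℚ : (ℕ → ℚ) → ℕ → ℚ
sumℚ a zero    = 0ℚ
sumℚ a (suc n) = sumℚ a n ℚ.+ a n

private
  two three : ℚ
  two   = 1ℚ ℚ.+ 1ℚ
  three = two ℚ.+ 1ℚ

  p-1<p : ∀ p → p ℚ.- 1ℚ ℚ.< p
  p-1<p p = subst (p ℚ.- 1ℚ ℚ.<_) (ℚP.+-identityʳ p)
    (ℚP.+-monoʳ-< p {ℚ.- 1ℚ} {0ℚ} (ℚP.negative⁻¹ (ℚ.- 1ℚ)))

  p<p+1 : ∀ p → p ℚ.< p ℚ.+ 1ℚ
  p<p+1 p = subst (ℚ._< p ℚ.+ 1ℚ) (ℚP.+-identityʳ p)
    (ℚP.+-monoʳ-< p {0ℚ} {1ℚ} (ℚP.positive⁻¹ 1ℚ))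

  shift : ∀ p q r → r ℚ.< p ℚ.+ q → r ℚ.- q ℚ.< p
  shift p q r lt = subst (r ℚ.- q ℚ.<_)
    (solve 2 (λ p q → (p :+ q) :- q := p) refl p q)
    (ℚP.+-monoˡ-< (ℚ.- q) lt)
    where open +-*-Solver

  unshift : ∀ q r → r ≡ (r ℚ.- q) ℚ.+ q
  unshift = solve 2 (λ q r → r := (r :- q) :+ q) refl
    where open +-*-Solver

-- The mathematics is classical: everything that follows is relative to
-- excluded middle, which makes Bool the type of truth values, X → Bool the
-- power set of X, and every proposition a truth value.

module Classical (em : ExcludedMiddle 0ℓ) where

  𝒫 : Set → Set
  𝒫 X = X → Bool

  infix 4 _∈_ _∉_ _⊆_ _≐_

  _∈_ _∉_ : {X : Set} → X → 𝒫 X → Set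
  x ∈ A = A x ≡ true
  x ∉ A = ¬ (x ∈ A)

  comprehension : {X : Set} → (X → Set) → 𝒫 X
  comprehension P x = does (em {P x})

  syntax comprehension (λ x → P) = ｛ x ∣ P ｝

  ∈-intro : {P : Set} → P → does (em {P}) ≡ true
  ∈-intro {P} p with em {P}
  ... | yes _ = refl
  ... | no ¬p = ⊥-elim (¬p p)

  ∈-elim : {P : Set} → does (em {P}) ≡ true → P
  ∈-elim {P} h with em {P} | h
  ... | yes p | _ = p

  _⊆_ _≐_ : {X : Set} → 𝒫 X → 𝒫 X → Set
  A ⊆ B = ∀ x → x ∈ A → x ∈ B
  A ≐ B = ∀ x → A x ≡ B x

  infixr 7 _∩_
  infixr 6 _∪_

  _∩_ _∪_ : {X : Set} → 𝒫 X → 𝒫 X → 𝒫 X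
  (A ∩ B) x = A x ∧ B x
  (A ∪ B) x = A x ∨ B x

  ∁ : {X : Set} → 𝒫 X → 𝒫 X
  ∁ A x = not (A x)

  univ : {X : Set} → 𝒫 X
  univ _ = true

  ⋃ : {X : Set} → (ℕ → 𝒫 X) → 𝒫 X
  ⋃ A = ｛ x ∣ ∃[ n ] x ∈ A n ｝

  -- Dedekind cuts, cut x = { r ∈ ℚ : r < x }
  record ℝ : Set where
    field
      cut       : 𝒫 ℚ
      inhabited : ∃[ r ] r ∈ cut
      bounded   : ∃[ r ] r ∉ cut
      downward  : ∀ {r r′} → r ℚ.< r′ → r′ ∈ cut → r ∈ cut
      rounded   : ∀ {r} → r ∈ cut → ∃[ r′ ] (r ℚ.< r′ × r′ ∈ cut)
  open ℝ public

  infix 4 _≤_ _<_ _≈_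

  _≤_ _<_ _≈_ : ℝ → ℝ → Set
  x ≤ y = cut x ⊆ cut y
  x < y = ∃[ r ] (r ∉ cut x × r ∈ cut y)
  x ≈ y = x ≤ y × y ≤ x

  fromℚ : ℚ → ℝ
  fromℚ q = record
    { cut       = ｛ r ∣ r ℚ.< q ｝
    ; inhabited = q ℚ.- 1ℚ , ∈-intro (p-1<p q)
    ; bounded   = q , λ h → ℚP.<-irrefl refl (∈-elim h)
    ; downward  = λ lt h → ∈-intro (ℚP.<-trans lt (∈-elim h))
    ; rounded   = λ h → let (m , a , b) = ℚP.<-dense (∈-elim h) in m , a , ∈-intro b
    }

  0ℝ 1ℝ : ℝ
  0ℝ = fromℚ 0ℚ
  1ℝ = fromℚ 1ℚ

  private
    below : (x : ℝ) {r r′ : ℚ} → r ∈ cut x → r′ ∉ cut x → r ℚ.< r′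
    below x {r} {r′} h h′ with ℚP.<-cmp r r′
    ... | tri< lt _ _   = lt
    ... | tri≈ _ refl _ = ⊥-elim (h′ h)
    ... | tri> _ _ gt   = ⊥-elim (h′ (downward x gt h))

  infixl 6 _+_

  _+_ : ℝ → ℝ → ℝ
  x + y = record
    { cut       = ｛ r ∣ ∃[ p ] ∃[ q ] (p ∈ cut x × q ∈ cut y × r ≡ p ℚ.+ q) ｝
    ; inhabited = let (p , hp) = inhabited x ; (q , hq) = inhabited y
                  in p ℚ.+ q , ∈-intro (p , q , hp , hq , refl)
    ; bounded   = let (p′ , hp′) = bounded x ; (q′ , hq′) = bounded y
                  in p′ ℚ.+ q′ , λ h → let (p , q , hp , hq , e) = ∈-elim h in
                     ℚP.<-irrefl (sym e) (ℚP.+-mono-< (below x hp hp′) (below y hq hq′))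
    ; downward  = λ {r} lt h → let (p , q , hp , hq , e) = ∈-elim h in
                  ∈-intro (r ℚ.- q , q
                          , downward x (shift p q r (subst (r ℚ.<_) e lt)) hp , hq , unshift q r)
    ; rounded   = λ h → let (p , q , hp , hq , e) = ∈-elim h ; (p′ , lt , hp′) = rounded x hp in
                  p′ ℚ.+ q , subst (ℚ._< p′ ℚ.+ q) (sym e) (ℚP.+-monoˡ-< q lt)
                , ∈-intro (p′ , q , hp′ , hq , refl)
    }

  sum : (ℕ → ℝ) → ℕ → ℝ
  sum x zero    = 0ℝ
  sum x (suc n) = sum x n + x n

  -- The series of nonnegative terms x has sum s.
  HasSum : (ℕ → ℝ) → ℝ → Set
  HasSum x s = (∀ n → sum x n ≤ s) × (∀ t → (∀ n → sum x n ≤ t) → s ≤ t)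

  record 𝕀 : Set where
    constructor mk𝕀
    field
      val   : ℝ
      0≤val : 0ℝ ≤ val
      val≤1 : val ≤ 1ℝ
  open 𝕀 public

  private
    0≤1 : 0ℝ ≤ 1ℝ
    0≤1 r h = ∈-intro (ℚP.<-trans (∈-elim h) (ℚP.positive⁻¹ 1ℚ))

  0𝕀 1𝕀 : 𝕀
  0𝕀 = mk𝕀 0ℝ (λ _ h → h) 0≤1
  1𝕀 = mk𝕀 1ℝ 0≤1 (λ _ h → h)

  -- A is covered by the open intervals ]a₀,b₀[ , ]a₁,b₁[ , …
  Covers : (a b : ℕ → ℚ) → 𝒫 𝕀 → Set
  Covers a b A = (∀ n → a n ℚ.≤ b n) ×
    (∀ t → t ∈ A → ∃[ n ] (fromℚ (a n) < val t × val t < fromℚ (b n)))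

  private
    a₀ b₀ : ℕ → ℚ
    a₀ zero    = ℚ.- 1ℚ
    a₀ (suc _) = 0ℚ
    b₀ zero    = two
    b₀ (suc _) = 0ℚ

    a₀≤b₀ : ∀ n → a₀ n ℚ.≤ b₀ n
    a₀≤b₀ zero    = ℚP.<⇒≤ (ℚP.neg<pos (ℚ.- 1ℚ) two)
    a₀≤b₀ (suc _) = ℚP.≤-refl

    covers₀ : ∀ A → Covers a₀ b₀ A
    covers₀ A = a₀≤b₀ , λ t _ → zero
      , ( ℚ.- 1ℚ , (λ h → ℚP.<-irrefl refl (∈-elim h))
        , 0≤val t _ (∈-intro (ℚP.negative⁻¹ (ℚ.- 1ℚ))))
      , ( 1ℚ , (λ h → ℚP.<-irrefl refl (∈-elim (val≤1 t _ h)))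
        , ∈-intro (p<p+1 1ℚ))

    len₀ : ∀ N → sumℚ (λ n → b₀ n ℚ.- a₀ n) N ℚ.≤ three
    len₀ zero          = ℚP.<⇒≤ (ℚP.positive⁻¹ three)
    len₀ (suc zero)    = ℚP.≤-refl
    len₀ (suc (suc N)) = subst (ℚ._≤ three) (sym (ℚP.+-identityʳ _)) (len₀ (suc N))

  -- The infimum of Σₙ (bₙ - aₙ) over all covers of A by open intervals, i.e.
  -- r < leb A iff some r′ > r is below the total length of every cover.  This
  -- is Lebesgue outer measure, hence Lebesgue measure on the Borel sets.
  leb : 𝒫 𝕀 → ℝ
  leb A = record
    { cut       = ｛ r ∣ ∃[ r′ ] (r ℚ.< r′ × (∀ a b → Covers a b A →
                           ∃[ N ] r′ ℚ.< sumℚ (λ n → b n ℚ.- a n) N)) ｝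
    ; inhabited = ℚ.- 1ℚ ℚ.- 1ℚ
                , ∈-intro (ℚ.- 1ℚ , p-1<p (ℚ.- 1ℚ) , λ _ _ _ → zero , ℚP.negative⁻¹ (ℚ.- 1ℚ))
    ; bounded   = three , λ h → let (r′ , lt , k) = ∈-elim h
                                    (N , lt′) = k a₀ b₀ (covers₀ A)
                                in ℚP.<-irrefl refl
                                     (ℚP.<-trans lt (ℚP.<-≤-trans lt′ (len₀ N)))
    ; downward  = λ lt h → let (r′ , lt′ , k) = ∈-elim h in
                  ∈-intro (r′ , ℚP.<-trans lt lt′ , k)
    ; rounded   = λ h → let (r′ , lt′ , k) = ∈-elim h ; (m , a , b) = ℚP.<-dense lt′ in
                  m , a , ∈-intro (r′ , b , k)
    }

  -- Σ_{1≤k≤m} leb { t : f t > k/m }, which is m times the integral of the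
  -- simple function Σ_{1≤k≤m} (1/m)·1_{f > k/m} below f.
  levelSum : (𝕀 → 𝕀) → (m : ℕ) .{{_ : ℕ.NonZero m}} → ℝ
  levelSum f m = sum (λ k → leb ｛ t ∣ fromℚ (+ suc k ℚ./ m) < val (f t) ｝) m

  private
    ratℕ : ℕ → ℚ
    ratℕ m = + m ℚ./ 1

    ratℕ-suc : ∀ m → ratℕ (suc m) ≡ ratℕ m ℚ.+ 1ℚ
    ratℕ-suc m = ℚP.toℚᵘ-injective
      (ℚᵘP.≃-trans (ℚP.toℚᵘ-fromℚᵘ (ℚᵘ.mkℚᵘ (+ suc m) 0))
      (ℚᵘP.≃-trans (ℚᵘ.*≡* (cong (ℤ._* + 1) (sym (trans (cong (ℤ._+ + 1) (ℤP.*-identityʳ (+ m))) (cong +_ (ℕP.+-comm m 1))))))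
      (ℚᵘP.≃-trans (ℚᵘP.+-congˡ ℚᵘ.1ℚᵘ (ℚᵘP.≃-sym (ℚP.toℚᵘ-fromℚᵘ (ℚᵘ.mkℚᵘ (+ m) 0))))
                   (ℚᵘP.≃-sym (ℚP.toℚᵘ-homo-+ (ratℕ m) 1ℚ)))))

    ratℕ-pos : ∀ m → ℚ.Positive (ratℕ (suc m))
    ratℕ-pos m = ℚP.normalize-pos (suc m) 1

    sum-leb< : ∀ (A : ℕ → 𝒫 𝕀) n {r} → r ∈ cut (sum (λ k → leb (A k)) n) →
               r ℚ.< ratℕ n ℚ.* three
    sum-leb< A zero    h = ∈-elim h
    sum-leb< A (suc n) h =
      let (p , q , hp , hq , e) = ∈-elim h
      in subst₂ ℚ._<_ (sym e)
           (trans (solve 2 (λ x t → x :* t :+ t := (x :+ con 1ℚ) :* t) refl (ratℕ n) three)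
                  (cong (ℚ._* three) (sym (ratℕ-suc n))))
           (ℚP.+-mono-< (sum-leb< A n hp) (below (leb (A n)) hq (proj₂ (bounded (leb (A n))))))
      where open +-*-Solver

    unscale : ∀ m r s → ratℕ (suc m) ℚ.* r ℚ.< s →
              ∃[ r′ ] (r ℚ.< r′ × ratℕ (suc m) ℚ.* r′ ≡ s)
    unscale m r s lt = r′ , ℚP.*-cancelˡ-<-nonNeg M (subst (M ℚ.* r ℚ.<_) (sym e) lt) , e
      where
      M = ratℕ (suc m)
      instance
        M>0 : ℚ.Positive M
        M>0 = ratℕ-pos m
        M≢0 : ℚ.NonZero M
        M≢0 = ℚP.pos⇒nonZero M
        M≥0 : ℚ.NonNegative M
        M≥0 = ℚP.pos⇒nonNeg M
      r′ = ℚ.1/ M ℚ.* s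
      e : M ℚ.* r′ ≡ s
      e = trans (sym (ℚP.*-assoc M (ℚ.1/ M) s))
                (trans (cong (ℚ._* s) (ℚP.*-inverseʳ M)) (ℚP.*-identityˡ s))

  -- The Lebesgue integral of f over [0,1]: the supremum over m ≥ 1 of the
  -- integrals (1/m)·levelSum f m; these simple functions converge uniformly
  -- to f from below.  Written multiplied by m: r < ∫ f iff m·r < levelSum f m
  -- for some m.
  ∫ : (𝕀 → 𝕀) → ℝ
  ∫ f = record
    { cut       = ｛ r ∣ ∃[ m ] ((+ suc m ℚ./ 1) ℚ.* r ∈ cut (levelSum f (suc m))) ｝
    ; inhabited = let (p , hp) = inhabited (levelSum f 1) in
                  p , ∈-intro (0 , subst (_∈ cut (levelSum f 1)) (sym (ℚP.*-identityˡ p)) hp)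
    ; bounded   = three , λ h → let (m , k) = ∈-elim h in
                  ℚP.<-irrefl refl (sum-leb< _ (suc m) k)
    ; downward  = λ lt h → let (m , k) = ∈-elim h in
                  ∈-intro (m , downward (levelSum f (suc m))
                    (ℚP.*-monoʳ-<-pos (ratℕ (suc m)) {{ratℕ-pos m}} lt) k)
    ; rounded   = λ {r} h →
                  let (m , k)       = ∈-elim h
                      (s , lt , hs) = rounded (levelSum f (suc m)) k
                      (r′ , lt′ , e) = unscale m r s lt
                  in r′ , lt′ , ∈-intro (m , subst (_∈ cut (levelSum f (suc m))) (sym e) hs)
    }

  record MeasurableSpace : Set₁ where
    field
      Carrier    : Set
      Measurable : 𝒫 Carrier → Set
      resp       : ∀ {A B} → A ≐ B → Measurable A → Measurable B
      whole      : Measurable univ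
      compl      : ∀ {A} → Measurable A → Measurable (∁ A)
      union      : ∀ {A : ℕ → 𝒫 Carrier} → (∀ n → Measurable (A n)) → Measurable (⋃ A)
  open MeasurableSpace public using (Carrier; Measurable)

  data Generated {X : Set} (G : 𝒫 X → Set) : 𝒫 X → Set where
    gen   : ∀ {A} → G A → Generated G A
    resp  : ∀ {A B} → A ≐ B → Generated G A → Generated G B
    whole : Generated G univ
    compl : ∀ {A} → Generated G A → Generated G (∁ A)
    union : ∀ {A : ℕ → 𝒫 X} → (∀ n → Generated G (A n)) → Generated G (⋃ A)

  generate : (X : Set) → (𝒫 X → Set) → MeasurableSpace
  generate X G = record
    { Carrier = X ; Measurable = Generated G
    ; resp = resp ; whole = whole ; compl = compl ; union = union }

  ℬ : MeasurableSpace → Set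
  ℬ S = Σ[ A ∈ 𝒫 (Carrier S) ] Measurable S A

  ∁ℬ : ∀ {S} → ℬ S → ℬ S
  ∁ℬ {S} (A , m) = ∁ A , MeasurableSpace.compl S m

  ⋃ℬ : ∀ {S} → (ℕ → ℬ S) → ℬ S
  ⋃ℬ {S} A = ⋃ (proj₁ ∘ A) , MeasurableSpace.union S (proj₂ ∘ A)

  private
    pair : {X : Set} → 𝒫 X → 𝒫 X → ℕ → 𝒫 X
    pair A B zero    = A
    pair A B (suc _) = B

    ∩-as-∁⋃ : {X : Set} (A B : 𝒫 X) → ∁ (⋃ (pair (∁ A) (∁ B))) ≐ A ∩ B
    ∩-as-∁⋃ A B x with em {∃[ n ] x ∈ pair (∁ A) (∁ B) n}
    ... | yes (zero , h) with A x | h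
    ...   | false | _ = refl
    ∩-as-∁⋃ A B x | yes (suc _ , h) with A x | B x | h
    ...   | true  | false | _ = refl
    ...   | false | false | _ = refl
    ∩-as-∁⋃ A B x | no ¬h with A x in a | B x in b
    ...   | true  | true  = refl
    ...   | false | _     = ⊥-elim (¬h (0 , cong not a))
    ...   | true  | false = ⊥-elim (¬h (1 , cong not b))

  _∩ℬ_ : ∀ {S} → ℬ S → ℬ S → ℬ S
  _∩ℬ_ {S} (A , mA) (B , mB) = A ∩ B ,
    M.resp (∩-as-∁⋃ A B)
      (M.compl (M.union (λ { zero → M.compl mA ; (suc _) → M.compl mB })))
    where module M = MeasurableSpace S

  infixr 2 _⊗_

  _⊗_ : MeasurableSpace → MeasurableSpace → MeasurableSpace
  S ⊗ T = generate (Carrier S × Carrier T) λ C →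
    Σ[ A ∈ ℬ S ] Σ[ B ∈ ℬ T ] C ≐ λ (x , y) → proj₁ A x ∧ proj₁ B y

  OpenIn𝕀 : 𝒫 𝕀 → Set
  OpenIn𝕀 U = ∀ t → t ∈ U → ∃[ a ] ∃[ b ]
    (fromℚ a < val t × val t < fromℚ b ×
     (∀ u → fromℚ a < val u → val u < fromℚ b → u ∈ U))

  [0,1] : MeasurableSpace
  [0,1] = generate 𝕀 OpenIn𝕀

  SouslinClosed : MeasurableSpace → Set
  SouslinClosed S = (A : List ℕ → 𝒫 (Carrier S)) → (∀ v → Measurable S (A v)) →
    Measurable S ｛ s ∣ ∃[ α ] (∀ n → s ∈ A (applyUpTo α n)) ｝

  Disjoint : {X : Set} → (ℕ → 𝒫 X) → Set
  Disjoint A = ∀ i j x → i ≢ j → x ∈ A i → x ∉ A j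

  record SubProb (S : MeasurableSpace) : Set where
    field
      μ        : ℬ S → 𝕀
      μ-resp   : ∀ A B → proj₁ A ≐ proj₁ B → val (μ A) ≈ val (μ B)
      additive : (A : ℕ → ℬ S) → Disjoint (proj₁ ∘ A) →
                 HasSum (λ n → val (μ (A n))) (val (μ (⋃ℬ {S} A)))
  open SubProb public

  Sub : MeasurableSpace → MeasurableSpace
  Sub S = generate (SubProb S) λ W →
    Σ[ A ∈ ℬ S ] Σ[ E ∈ ℬ [0,1] ] W ≐ λ ν → proj₁ E (μ ν A)

  private
    indicator : Bool → 𝕀
    indicator b = if b then 1𝕀 else 0𝕀

    +-zeroʳ : ∀ x → x + 0ℝ ≤ x
    +-zeroʳ x r h = let (p , q , hp , hq , e) = ∈-elim h in
      downward x (subst₂ ℚ._<_ (sym e) (ℚP.+-identityʳ p) (ℚP.+-monoʳ-< p (∈-elim hq))) hp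

    +-zeroˡ : ∀ x → 0ℝ + x ≤ x
    +-zeroˡ x r h = let (p , q , hp , hq , e) = ∈-elim h in
      downward x (subst₂ ℚ._<_ (sym e) (ℚP.+-identityˡ q) (ℚP.+-monoˡ-< q (∈-elim hp))) hq

    ≤-+ˡ : ∀ x y → 0ℝ ≤ x → y ≤ x + y
    ≤-+ˡ x y 0≤x r h = let (q , lt , hq) = rounded y h in
      ∈-intro (r ℚ.- q , q
              , 0≤x _ (∈-intro (subst (r ℚ.- q ℚ.<_) (ℚP.+-inverseʳ q) (ℚP.+-monoˡ-< (ℚ.- q) lt)))
              , hq , unshift q r)

    0≤+ : ∀ x y → 0ℝ ≤ x → 0ℝ ≤ y → 0ℝ ≤ x + y
    0≤+ x y 0≤x 0≤y r h = ≤-+ˡ x y 0≤x r (0≤y r h)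

    0≤sum : ∀ (x : ℕ → 𝕀) n → 0ℝ ≤ sum (val ∘ x) n
    0≤sum x zero    r h = h
    0≤sum x (suc n) r h = 0≤+ (sum (val ∘ x) n) (val (x n)) (0≤sum x n) (0≤val (x n)) r h

    sum-indicator₀ : ∀ (b : ℕ → Bool) n → (∀ i → i ℕ.< n → b i ≢ true) →
                     sum (val ∘ indicator ∘ b) n ≤ 0ℝ
    sum-indicator₀ b zero    z r h = h
    sum-indicator₀ b (suc n) z r h with b n in e
    ... | true  = ⊥-elim (z n ℕP.≤-refl e)
    ... | false = sum-indicator₀ b n (λ i lt → z i (ℕP.m≤n⇒m≤1+n lt)) r
                    (+-zeroʳ (sum (val ∘ indicator ∘ b) n) r h)

    sum-indicator₁ : ∀ (b : ℕ → Bool) → (∀ i j → i ≢ j → b i ≡ true → b j ≢ true) →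
                     ∀ n → sum (val ∘ indicator ∘ b) n ≤ 1ℝ
    sum-indicator₁ b d zero    r h = 0≤1 r h
    sum-indicator₁ b d (suc n) r h with b n in e
    ... | false = sum-indicator₁ b d n r (+-zeroʳ (sum (val ∘ indicator ∘ b) n) r h)
    ... | true  = let (p , q , hp , hq , eq) = ∈-elim h in
      +-zeroˡ 1ℝ r (∈-intro (p , q
        , sum-indicator₀ b n (λ i lt → d n i (λ n≡i → ℕP.<-irrefl (sym n≡i) lt) e) p hp
        , hq , eq))

    indicator-sum : ∀ (b : ℕ → Bool) → (∀ i j → i ≢ j → b i ≡ true → b j ≢ true) →
                    HasSum (val ∘ indicator ∘ b) (val (indicator (does (em {∃[ n ] b n ≡ true}))))
    indicator-sum b d with em {∃[ n ] b n ≡ true}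
    ... | no ¬e = (λ n → sum-indicator₀ b n (λ i _ e → ¬e (i , e)))
                , λ t ub → ub 0
    ... | yes (k , e) = sum-indicator₁ b d , λ t ub r h → ub (suc k) r (term r h)
      where
      term : 1ℝ ≤ sum (val ∘ indicator ∘ b) (suc k)
      term r h = ≤-+ˡ (sum (val ∘ indicator ∘ b) k) (val (indicator (b k)))
                      (0≤sum (indicator ∘ b) k) r
                      (subst (λ c → r ∈ cut (val (indicator c))) (sym e) h)

  δ : ∀ {S} → Carrier S → SubProb S
  δ s = record
    { μ        = λ A → indicator (proj₁ A s)
    ; μ-resp   = λ A B eq → (λ r → subst (λ c → r ∈ cut (val (indicator c))) (eq s))
                          , (λ r → subst (λ c → r ∈ cut (val (indicator c))) (sym (eq s)))
    ; additive = λ A d → indicator-sum (λ n → proj₁ (A n) s) (λ i j → d i j s)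
    }

  private
    ∉-intro : {P : Set} → ¬ P → does (em {P}) ≡ false
    ∉-intro {P} ¬p with em {P}
    ... | yes p = ⊥-elim (¬p p)
    ... | no _  = refl

    ∩-⋃ : {X : Set} (A : 𝒫 X) (B : ℕ → 𝒫 X) → A ∩ ⋃ B ≐ ⋃ (λ n → A ∩ B n)
    ∩-⋃ A B x with A x
    ... | true  = refl
    ... | false = sym (∉-intro λ ())

    ∩-elimʳ : ∀ a {b} → a ∧ b ≡ true → b ≡ true
    ∩-elimʳ true h = h

  restrict : ∀ {S} → ℬ S → SubProb S → SubProb S
  restrict {S} A ν = record
    { μ        = λ B → μ ν (A ∩S B)
    ; μ-resp   = λ B C eq → μ-resp ν (A ∩S B) (A ∩S C) (λ x → cong (proj₁ A x ∧_) (eq x))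
    ; additive = λ B d →
        let (ub , lub) = additive ν (λ n → A ∩S B n)
              (λ i j x i≢j hi hj → d i j x i≢j (∩-elimʳ (proj₁ A x) hi) (∩-elimʳ (proj₁ A x) hj))
            (le , ge)  = μ-resp ν (A ∩S ⋃ℬ {S} B) (⋃ℬ {S} (λ n → A ∩S B n))
                           (∩-⋃ (proj₁ A) (proj₁ ∘ B))
        in (λ n r h → ge r (ub n r h)) , λ t h r hr → lub t h r (le r hr)
    }
    where
    _∩S_ : ℬ S → ℬ S → ℬ S
    _∩S_ = _∩ℬ_ {S}

  -- ν(A) for an arbitrary set A, with the junk value 0 when A is not
  -- measurable: the interpretation of games is defined before its sets are
  -- known to be measurable.
  _⟪_⟫ : ∀ {S} → SubProb S → 𝒫 (Carrier S) → 𝕀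
  _⟪_⟫ {S} ν A with em {Measurable S A}
  ... | yes m = μ ν (A , m)
  ... | no  _ = 0𝕀

  -- P s is a set of subsets of SubProb S; that its members are measurable is
  -- part of IsStochasticEffectivity.
  EffMap : MeasurableSpace → Set₁
  EffMap S = Carrier S → 𝒫 (SubProb S) → Set

  TMeasurable : ∀ {S} → EffMap S → Set
  TMeasurable {S} P = ∀ H → Measurable (Sub S ⊗ [0,1]) H →
    Measurable (S ⊗ [0,1]) ｛ (s , q) ∣ P s (λ ν → H (ν , q)) ｝

  record IsStochasticEffectivity (S : MeasurableSpace) (P : EffMap S) : Set where
    field
      measurable  : ∀ s W → P s W → Measurable (Sub S) W
      upward      : ∀ s V W → P s V → V ⊆ W → Measurable (Sub S) W → P s W
      tMeasurable : TMeasurable {S} P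

  I-Dirac : ∀ {S} → EffMap S
  I-Dirac {S} s W = Measurable (Sub S) W × δ {S} s ∈ W

  test? : ∀ {S} → ℬ S → EffMap S
  test? {S} A s W = Measurable (Sub S) W × I-Dirac {S} s (λ ν → W (restrict {S} A ν))

  test¿ : ∀ {S} → ℬ S → EffMap S
  test¿ {S} A s W = Measurable (Sub S) W × I-Dirac {S} s (λ ν → W (restrict {S} (∁ℬ {S} A) ν))

  record GameFrame (Γ : Set) (ε : Γ) : Set₁ where
    field
      space  : MeasurableSpace
      P      : Γ → EffMap space
      P-eff  : ∀ γ → IsStochasticEffectivity space (P γ)
      P-ε    : ∀ s W → P ε s W ⇔ I-Dirac {space} s W

  module Interpretation {Γ : Set} {ε : Γ} (F : GameFrame Γ ε) where
    open GameFrame F renaming (space to S)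

    -- The type of (A , q) ↦ 𝔍(τ | A, q); only q ≥ 0 and measurable A matter.
    Sem : Set
    Sem = 𝒫 (Carrier S) → ℝ → 𝒫 (Carrier S)

    β : 𝒫 (Carrier S) → ℝ → 𝒫 (SubProb S)
    β A q = ｛ ν ∣ q < val (ν ⟪ A ⟫) ｝

    dual : Sem → Sem
    dual K A q = ∁ (K (∁ A) q)

    Q² : ℝ → ℚ × ℚ → Set
    Q² q (a₁ , a₂) = 0ℚ ℚ.≤ a₁ × 0ℚ ℚ.≤ a₂ × fromℚ (a₁ ℚ.+ a₂) ≤ q

    Q^∞ : ℝ → (ℕ → ℚ) → Set
    Q^∞ q a = (∀ n → 0ℚ ℚ.≤ a n) × (∀ n → fromℚ (sumℚ a n) ≤ q)

    angelic : Sem → Sem → Sem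
    angelic K L A q =
      ｛ s ∣ (∀ a₁ a₂ → Q² q (a₁ , a₂) → s ∈ K A (fromℚ a₁) ∪ L A (fromℚ a₂)) ｝

    demonic : Sem → Sem → Sem
    demonic K L = dual (angelic (dual K) (dual L))

    -- With K n = 𝔍(τⁿ ; τ₀ | –) this is 𝔍(τ* ; τ₀ | –).
    iteration : (ℕ → Sem) → Sem
    iteration K A q =
      ｛ s ∣ (∀ a → Q^∞ q a → ∃[ n ] s ∈ K n A (fromℚ (a n))) ｝

    G : Sem → 𝒫 (Carrier S) → ℝ → 𝒫 (SubProb S)
    G K A q = ｛ ν ∣ q < ∫ (λ r → ν ⟪ K A (val r) ⟫) ｝

    -- 𝔍(τ ; τ₀ | –) depends on τ₀ only through K = 𝔍(τ₀ | –).  The clauses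
    -- follow the identifications
    --   τᵈ ; τ₀        = (τ ; τ₀ᵈ)ᵈ
    --   (τ₁ ∪ τ₂) ; τ₀ = τ₁ ; τ₀ ∪ τ₂ ; τ₀
    --   (τ₁ ∩ τ₂) ; τ₀ = τ₁ ; τ₀ ∩ τ₂ ; τ₀   (from τ₁ ∩ τ₂ = (τ₁ᵈ ∪ τ₂ᵈ)ᵈ)
    --   (τ₁ ; τ₂) ; τ₀ = τ₁ ; (τ₂ ; τ₀)
    --   τˣ ; τ₀        = ((τᵈ)* ; τ₀ᵈ)ᵈ      (from (τˣ)ᵈ = (τᵈ)*)
    𝔍； : Game Γ → Sem → Sem
    𝔍； (prim γ)  K A q = ｛ s ∣ P γ s (G K A q) ｝
    𝔍； (τ ᵈ)     K = dual (𝔍； τ (dual K))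
    𝔍； (τ₁ ⊍ τ₂) K = angelic (𝔍； τ₁ K) (𝔍； τ₂ K)
    𝔍； (τ₁ ⩀ τ₂) K = demonic (𝔍； τ₁ K) (𝔍； τ₂ K)
    𝔍； (τ₁ ； τ₂) K = 𝔍； τ₁ (𝔍； τ₂ K)
    𝔍； (τ *)     K = iteration (λ n → fold K (𝔍； τ) n)
    𝔍； (τ ˣ)     K = dual (iteration (λ n → fold (dual K) (λ L → dual (𝔍； τ (dual L))) n))

    𝔍-prim : Γ → Sem
    𝔍-prim γ A q = ｛ s ∣ P γ s (β A q) ｝

    -- A final τ* is read as τ* ; ε, and τˣ as ((τᵈ)*)ᵈ.
    𝔍 : Game Γ → Sem
    𝔍 (prim γ)  = 𝔍-prim γ
    𝔍 (τ ᵈ)     = dual (𝔍 τ)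
    𝔍 (τ₁ ⊍ τ₂) = angelic (𝔍 τ₁) (𝔍 τ₂)
    𝔍 (τ₁ ⩀ τ₂) = demonic (𝔍 τ₁) (𝔍 τ₂)
    𝔍 (τ₁ ； τ₂) = 𝔍； τ₁ (𝔍 τ₂)
    𝔍 (τ *)     = 𝔍； (τ *) (𝔍-prim ε)
    𝔍 (τ ˣ)     = dual (𝔍； (τ ᵈ *) (𝔍-prim ε))

  data Formula (Γ Ψ : Set) : Set where
    ⊤′      : Formula Γ Ψ
    atom    : Ψ → Formula Γ Ψ
    _∧′_    : Formula Γ Ψ → Formula Γ Ψ → Formula Γ Ψ
    ⟨_⟩[_]_ : Game Γ → 𝕀 → Formula Γ Ψ → Formula Γ Ψ

  record GameModel (Γ : Set) (ε : Γ) (Ψ : Set) : Set₁ where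
    field
      frame : GameFrame Γ ε
    open GameFrame frame public using (space)
    field
      V : Ψ → ℬ space

  module _ {Γ : Set} {ε : Γ} {Ψ : Set} (𝒢 : GameModel Γ ε Ψ) where
    open GameModel 𝒢
    open Interpretation frame

    ⟦_⟧ : Formula Γ Ψ → 𝒫 (Carrier space)
    ⟦ ⊤′ ⟧             = univ
    ⟦ atom p ⟧         = proj₁ (V p)
    ⟦ φ₁ ∧′ φ₂ ⟧       = ⟦ φ₁ ⟧ ∩ ⟦ φ₂ ⟧
    ⟦ ⟨ τ ⟩[ q ] φ ⟧   = 𝔍 τ ⟦ φ ⟧ (val q)

-- Each set 𝔍(τ | A, q) is monotone in the threshold q: ∪, * and primitive games
-- make it decreasing, and a dual reverses the direction.  Hence
-- {t : ν(𝔍(τ | A, t)) > c} is an order ideal or filter of [0,1], whose Lebesgue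
-- measure is the supremum of v - u over rational members u and v (Heine–Borel),
-- so ∫ ν(𝔍(τ | A, t)) dt is a measurable function of ν without any Fubini
-- theorem.  t-measurability then settles primitive games; for τ* and fixed q,
-- the complement is a Souslin set over words that encode sequences of rationals.
-- So validity sets are measurable, and tests are stochastic effectivity
-- functions because s ↦ F_A(δ_s) is measurable.

module Submission where

open import Axiom.ExcludedMiddle using (ExcludedMiddle)
open import Data.Bool.Base using (Bool; true; false; not; _∧_; _∨_; if_then_else_)
open import Data.Bool.Properties using (∧-identityʳ; ∧-zeroʳ)
open import Data.Integer.Base using (+_; -[1+_]; _⊖_)
open import Data.List.Base using (List; []; _∷_; length; applyUpTo)
open import Data.List.Properties using (length-applyUpTo)
open import Data.Nat.Base as ℕ using (ℕ; zero; suc)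
open import Data.Nat.GeneralisedArithmetic using (fold)
import Data.Nat.Properties as ℕP
open import Data.Product.Base using (Σ-syntax; ∃-syntax; _×_; _,_; proj₁; proj₂)
open import Data.Rational.Base as ℚ using (ℚ; mkℚ; 0ℚ; 1ℚ; ½)
import Data.Rational.Properties as ℚP
open import Data.Rational.Solver using (module +-*-Solver)
open import Data.Sum.Base using (_⊎_; inj₁; inj₂)
open import Data.Unit.Base using (⊤; tt)
open import Level using (0ℓ)
open import Relation.Binary.Definitions using (tri<; tri≈; tri>)
open import Relation.Binary.PropositionalEquality
  using (_≡_; _≢_; refl; sym; trans; cong; cong₂; subst; subst₂)
open import Relation.Nullary using (¬_; does; yes; no; contradiction)
open import Defs

-- Enumeration of the rationals

-- Runs down each antidiagonal from `(n , 0)` to `(0 , n)`, then jumps to `(suc n , 0)`: Cantor's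
-- enumeration of pairs.
next : ℕ × ℕ → ℕ × ℕ
next (zero  , b) = suc b , 0
next (suc a , b) = a , suc b

unpair : ℕ → ℕ × ℕ
unpair zero    = 0 , 0
unpair (suc n) = next (unpair n)

unpair-surjective : ∀ p → ∃[ n ] unpair n ≡ p
unpair-surjective (a , b) = along b a (axis (b ℕ.+ a))
  where
  -- `along` walks down an antidiagonal from its starting point on the axis; `axis` reaches the next
  -- starting point by finishing the previous antidiagonal.
  along : ∀ b a → ∃[ n ] unpair n ≡ (b ℕ.+ a , 0) → ∃[ n ] unpair n ≡ (a , b)
  along zero    a h = h
  along (suc b) a (n , h) =
    let (m , e) = along b (suc a) (n , trans h (cong (_, 0) (sym (ℕP.+-suc b a))))
    in suc m , cong next e
  axis : ∀ a → ∃[ n ] unpair n ≡ (a , 0)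
  axis zero    = 0 , refl
  axis (suc a) =
    let (m , e) = along a 0 (subst (λ k → ∃[ n ] unpair n ≡ (k , 0)) (sym (ℕP.+-identityʳ a)) (axis a))
    in suc m , cong next e

-- `d` codes the denominator `suc d`, and `m` codes a pair whose difference is the numerator, so
-- that negative rationals are reached too.
fraction : ℕ × ℕ → ℚ
fraction (d , m) = let (b , c) = unpair m in (b ⊖ c) ℚ./ suc d

enumℚ : ℕ → ℚ
enumℚ n = fraction (unpair n)

enumℚ-surjective : ∀ r → ∃[ n ] enumℚ n ≡ r
enumℚ-surjective r@(mkℚ i d _) =
  let (bc , e)  = difference i
      (m , eₘ)  = unpair-surjective bc
      (n , eₙ)  = unpair-surjective (d , m)
  in n , trans (cong fraction eₙ)
        (trans (cong (λ (b , c) → (b ⊖ c) ℚ./ suc d) eₘ)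
        (trans (cong (ℚ._/ suc d) e) (ℚP.↥p/↧p≡p r)))
  where
  difference : ∀ i → ∃[ bc ] proj₁ bc ⊖ proj₂ bc ≡ i
  difference (+ n)    = (n , 0) , refl
  difference -[1+ n ] = (0 , suc n) , refl

-- Lengths of finite families of intervals

0≤q-p : ∀ {p q} → p ℚ.≤ q → 0ℚ ℚ.≤ q ℚ.- p
0≤q-p {p} {q} le = subst (ℚ._≤ q ℚ.- p) (ℚP.+-inverseʳ p) (ℚP.+-monoˡ-≤ (ℚ.- p) le)


sumℚ-cong : ∀ {f g} N → (∀ n → n ℕ.< N → f n ≡ g n) → sumℚ f N ≡ sumℚ g N
sumℚ-cong zero    e = refl
sumℚ-cong (suc N) e =
  cong₂ ℚ._+_ (sumℚ-cong N (λ n lt → e n (ℕP.m≤n⇒m≤1+n lt))) (e N ℕP.≤-refl)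

sumℚ-mono : ∀ {f g} N → (∀ n → f n ℚ.≤ g n) → sumℚ f N ℚ.≤ sumℚ g N
sumℚ-mono zero    le = ℚP.≤-refl
sumℚ-mono (suc N) le = ℚP.+-mono-≤ (sumℚ-mono N le) (le N)

p≤p+q : ∀ p {q} → 0ℚ ℚ.≤ q → p ℚ.≤ p ℚ.+ q
p≤p+q p {q} 0≤q = subst (ℚ._≤ p ℚ.+ q) (ℚP.+-identityʳ p) (ℚP.+-monoʳ-≤ p 0≤q)

q≤p+q : ∀ {p} q → 0ℚ ℚ.≤ p → q ℚ.≤ p ℚ.+ q
q≤p+q {p} q 0≤p = subst (ℚ._≤ p ℚ.+ q) (ℚP.+-identityˡ q) (ℚP.+-monoˡ-≤ q 0≤p)

p<p+q : ∀ p {q} → 0ℚ ℚ.< q → p ℚ.< p ℚ.+ q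
p<p+q p {q} 0<q = subst (ℚ._< p ℚ.+ q) (ℚP.+-identityʳ p) (ℚP.+-monoʳ-< p 0<q)

sumℚ-nonneg : ∀ {f} N → (∀ n → n ℕ.< N → 0ℚ ℚ.≤ f n) → 0ℚ ℚ.≤ sumℚ f N
sumℚ-nonneg zero    pos = ℚP.≤-refl
sumℚ-nonneg {f} (suc N) pos =
  ℚP.≤-trans (sumℚ-nonneg N (λ n lt → pos n (ℕP.m≤n⇒m≤1+n lt)))
             (p≤p+q (sumℚ f N) (pos N ℕP.≤-refl))

sumℚ-extend : ∀ {f} → (∀ n → 0ℚ ℚ.≤ f n) → ∀ M N → sumℚ f N ℚ.≤ sumℚ f (M ℕ.+ N)
sumℚ-extend     pos zero    N = ℚP.≤-refl
sumℚ-extend {f} pos (suc M) N =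
  ℚP.≤-trans (sumℚ-extend pos M N) (p≤p+q (sumℚ f (M ℕ.+ N)) (pos (M ℕ.+ N)))

sumℚ-gain : ∀ {f g d k} N → (∀ n → f n ℚ.≤ g n) → f k ℚ.+ d ℚ.≤ g k → k ℕ.< N →
            sumℚ f N ℚ.+ d ℚ.≤ sumℚ g N
sumℚ-gain {f} {g} {d} {k} (suc N) le gain k<1+N with ℕP.m≤n⇒m<n∨m≡n (ℕ.s≤s⁻¹ k<1+N)
... | inj₁ k<N  = subst (ℚ._≤ sumℚ g N ℚ.+ g N)
    (solve 3 (λ s d x → (s :+ d) :+ x := (s :+ x) :+ d) refl (sumℚ f N) d (f N))
    (ℚP.+-mono-≤ (sumℚ-gain N le gain k<N) (le N))
  where open +-*-Solver
... | inj₂ refl = subst (ℚ._≤ sumℚ g N ℚ.+ g N) (sym (ℚP.+-assoc (sumℚ f N) (f N) d))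
    (ℚP.+-mono-≤ (sumℚ-mono N le) gain)

-- The length of ]a , b[ ∩ ]-∞ , x[.
lengthBelow : ℚ → ℚ → ℚ → ℚ
lengthBelow a b x = 0ℚ ℚ.⊔ ((b ℚ.⊓ x) ℚ.- a)

lengthBelow-nonneg : ∀ a b x → 0ℚ ℚ.≤ lengthBelow a b x
lengthBelow-nonneg a b x = ℚP.p≤p⊔q 0ℚ ((b ℚ.⊓ x) ℚ.- a)

lengthBelow-mono : ∀ a b {x y} → x ℚ.≤ y → lengthBelow a b x ℚ.≤ lengthBelow a b y
lengthBelow-mono a b x≤y = ℚP.⊔-monoʳ-≤ 0ℚ (ℚP.+-monoˡ-≤ (ℚ.- a) (ℚP.⊓-monoʳ-≤ b x≤y))

lengthBelow-bound : ∀ {a b} x → a ℚ.≤ b → lengthBelow a b x ℚ.≤ b ℚ.- a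
lengthBelow-bound {a} {b} x a≤b =
  ℚP.⊔-lub (0≤q-p a≤b) (ℚP.+-monoˡ-≤ (ℚ.- a) (ℚP.p⊓q≤p b x))

-- The length below `x` is at most `x - a`, and the length below `y` is at least `y - a`.
lengthBelow-gain : ∀ {a b x y} → a ℚ.≤ x → y ℚ.≤ b →
                   lengthBelow a b x ℚ.+ (y ℚ.- x) ℚ.≤ lengthBelow a b y
lengthBelow-gain {a} {b} {x} {y} a≤x y≤b = ℚP.≤-trans
  (ℚP.+-monoˡ-≤ (y ℚ.- x)
    (ℚP.⊔-lub (0≤q-p a≤x) (ℚP.+-monoˡ-≤ (ℚ.- a) (ℚP.p⊓q≤q b x))))
  (subst (ℚ._≤ lengthBelow a b y)
    (trans (cong (ℚ._- a) (ℚP.p≥q⇒p⊓q≡q y≤b))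
           (solve 3 (λ a x y → y :- a := (x :- a) :+ (y :- x)) refl a x y))
    (ℚP.p≤q⊔p 0ℚ ((b ℚ.⊓ y) ℚ.- a)))
  where open +-*-Solver

module _ (em : ExcludedMiddle 0ℓ) where
  open Classical em

  -- Classical reasoning with truth values

  by-contradiction : {P : Set} → ¬ ¬ P → P
  by-contradiction {P} ¬¬p with em {P}
  ... | yes p = p
  ... | no ¬p = contradiction ¬p ¬¬p

  does-⇔ : {P Q : Set} → (P → Q) → (Q → P) → does (em {P}) ≡ does (em {Q})
  does-⇔ {P} {Q} f g with em {P} | em {Q}
  ... | yes _ | yes _ = refl
  ... | no _  | no _  = refl
  ... | yes p | no ¬q = contradiction (f p) ¬q
  ... | no ¬p | yes q = contradiction (g q) ¬p

  does-true : (b : Bool) → does (em {b ≡ true}) ≡ b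
  does-true true  = ∈-intro refl
  does-true false with em {false ≡ true}
  ... | no _ = refl

  does-not : (P : Set) → not (does (em {P})) ≡ does (em {¬ P})
  does-not P with em {P} | em {¬ P}
  ... | yes p | yes ¬p = contradiction p ¬p
  ... | yes _ | no _   = refl
  ... | no _  | yes _  = refl
  ... | no ¬p | no ¬¬p = contradiction ¬p ¬¬p

  ∧-intro : ∀ {a b} → a ≡ true → b ≡ true → a ∧ b ≡ true
  ∧-intro refl refl = refl

  ∧-elim : ∀ {a b} → a ∧ b ≡ true → a ≡ true × b ≡ true
  ∧-elim {true} {true} _ = refl , refl

  not-intro : ∀ {b} → b ≢ true → not b ≡ true
  not-intro {true}  ne = contradiction refl ne
  not-intro {false} ne = refl

  not-elim : ∀ {b} → not b ≡ true → b ≢ true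
  not-elim {false} _ ()

  ∁-antitone : {X : Set} {A B : 𝒫 X} → A ⊆ B → ∁ B ⊆ ∁ A
  ∁-antitone A⊆B x x∉B = not-intro λ x∈A → not-elim x∉B (A⊆B x x∈A)

  -- Measurable predicates

  module _ (S : MeasurableSpace) where
    private module S = MeasurableSpace S

    Meas : (Carrier S → Set) → Set
    Meas P = Measurable S ｛ x ∣ P x ｝

  module _ {S : MeasurableSpace} where
    private module S = MeasurableSpace S

    Meas-⇔ : {P Q : Carrier S → Set} → (∀ x → P x → Q x) → (∀ x → Q x → P x) → Meas S P → Meas S Q
    Meas-⇔ f g = S.resp λ x → does-⇔ (f x) (g x)

    Meas-∈ : ∀ {A} → Measurable S A → Meas S (_∈ A)
    Meas-∈ {A} = S.resp λ x → sym (does-true (A x))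

    Meas-¬ : {P : Carrier S → Set} → Meas S P → Meas S (λ x → ¬ P x)
    Meas-¬ {P} m = S.resp (λ x → does-not (P x)) (S.compl m)

    Meas-∃ : {P : ℕ → Carrier S → Set} → (∀ n → Meas S (P n)) → Meas S (λ x → ∃[ n ] P n x)
    Meas-∃ {P} m = Meas-⇔ (λ x (n , h) → n , ∈-elim h) (λ x (n , h) → n , ∈-intro h) (S.union m)

    Meas-const : {C : Set} → Meas S (λ _ → C)
    Meas-const {C} with em {C}
    ... | yes _ = S.whole
    ... | no _  = S.compl S.whole

    Meas-∃ℚ : {P : ℚ → Carrier S → Set} → (∀ q → Meas S (P q)) → Meas S (λ x → ∃[ q ] P q x)
    Meas-∃ℚ {P} m = Meas-⇔ (λ x (n , h) → enumℚ n , h)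
      (λ x (q , h) → let (n , e) = enumℚ-surjective q in n , subst (λ q → P q x) (sym e) h)
      (Meas-∃ λ n → m (enumℚ n))

    Meas-∀ : {P : ℕ → Carrier S → Set} → (∀ n → Meas S (P n)) → Meas S (λ x → ∀ n → P n x)
    Meas-∀ m = Meas-⇔ (λ x h n → by-contradiction λ ¬p → h (n , ¬p)) (λ x h (n , ¬p) → ¬p (h n))
      (Meas-¬ (Meas-∃ λ n → Meas-¬ (m n)))

    Meas-∀ℚ : {P : ℚ → Carrier S → Set} → (∀ q → Meas S (P q)) → Meas S (λ x → ∀ q → P q x)
    Meas-∀ℚ m = Meas-⇔ (λ x h q → by-contradiction λ ¬p → h (q , ¬p)) (λ x h (q , ¬p) → ¬p (h q))
      (Meas-¬ (Meas-∃ℚ λ q → Meas-¬ (m q)))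

    Meas-∪ : {A B : 𝒫 (Carrier S)} → Measurable S A → Measurable S B → Measurable S (A ∪ B)
    Meas-∪ {A} {B} mA mB = S.resp (λ x → deMorgan (A x) (B x))
      (S.compl (proj₂ (_∩ℬ_ {S} (∁ A , S.compl mA) (∁ B , S.compl mB))))
      where
      deMorgan : ∀ a b → not (not a ∧ not b) ≡ a ∨ b
      deMorgan true  _     = refl
      deMorgan false true  = refl
      deMorgan false false = refl

    Meas-× : {P Q : Carrier S → Set} → Meas S P → Meas S Q → Meas S (λ x → P x × Q x)
    Meas-× {P} {Q} mP mQ = S.resp
      (λ x → trans (sym (does-true _)) (does-⇔
        (λ h → let (p , q) = ∧-elim h in ∈-elim p , ∈-elim q)
        (λ (p , q) → ∧-intro (∈-intro p) (∈-intro q))))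
      (proj₂ (_∩ℬ_ {S} (｛ x ∣ P x ｝ , mP) (｛ x ∣ Q x ｝ , mQ)))

    Meas-⊎ : {P Q : Carrier S → Set} → Meas S P → Meas S Q → Meas S (λ x → P x ⊎ Q x)
    Meas-⊎ {P} {Q} mP mQ = Meas-⇔
      (λ x h → by-contradiction λ ¬pq → h ((λ p → ¬pq (inj₁ p)) , λ q → ¬pq (inj₂ q)))
      (λ { x (inj₁ p) (¬p , _) → ¬p p ; x (inj₂ q) (_ , ¬q) → ¬q q })
      (Meas-¬ (Meas-× (Meas-¬ mP) (Meas-¬ mQ)))

    -- Excluded middle on `C` lets measurability of `P` be proved under the assumption `C`. Later,
    -- side conditions of this kind place thresholds in [0,1], where measurability is available.
    Meas-→ : {C : Set} {P : Carrier S → Set} → (C → Meas S P) → Meas S (λ x → C → P x)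
    Meas-→ {C} m with em {C}
    ... | yes c = Meas-⇔ (λ x p _ → p) (λ x h → h c) (m c)
    ... | no ¬c = Meas-⇔ {P = λ _ → ⊤} (λ x _ c → contradiction c ¬c) (λ x _ → tt) Meas-const

    Meas-const× : {C : Set} {P : Carrier S → Set} → (C → Meas S P) → Meas S (λ x → C × P x)
    Meas-const× {C} m with em {C}
    ... | yes c = Meas-⇔ (λ x p → c , p) (λ x → proj₂) (m c)
    ... | no ¬c = Meas-⇔ {P = λ _ → C} (λ x c → contradiction c ¬c) (λ x → proj₁) Meas-const

  -- Real numbers and the unit interval

  fromℚ-mono : ∀ {p q} → p ℚ.≤ q → fromℚ p ≤ fromℚ q
  fromℚ-mono p≤q r h = ∈-intro (ℚP.<-≤-trans (∈-elim h) p≤q)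

  fromℚ-cancel : ∀ {p q} → fromℚ p ≤ fromℚ q → p ℚ.≤ q
  fromℚ-cancel le = ℚP.≮⇒≥ λ q<p → ℚP.<-irrefl refl (∈-elim (le _ (∈-intro q<p)))

  ∈cut⇒fromℚ≤ : ∀ x {r} → r ∈ cut x → fromℚ r ≤ x
  ∈cut⇒fromℚ≤ x h s h′ = downward x (∈-elim h′) h

  ∉cut⇒≤fromℚ : ∀ x {r} → r ∉ cut x → x ≤ fromℚ r
  ∉cut⇒≤fromℚ x {r} h s h′ with s ℚP.<? r
  ... | yes s<r = ∈-intro s<r
  ... | no s≮r  with ℚP.<-cmp r s
  ...   | tri< r<s _ _  = contradiction (downward x r<s h′) h
  ...   | tri≈ _ refl _ = contradiction h′ h
  ...   | tri> _ _ s<r  = contradiction s<r s≮r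

  <⇒∈cut : ∀ {r} x → fromℚ r < x → r ∈ cut x
  <⇒∈cut {r} x (s , s∉ , s∈) with ℚP.<-cmp r s
  ... | tri< r<s _ _  = downward x r<s s∈
  ... | tri≈ _ refl _ = s∈
  ... | tri> _ _ s<r  = contradiction (∈-intro s<r) s∉

  ∈cut⇒< : ∀ {r} x → r ∈ cut x → fromℚ r < x
  ∈cut⇒< {r} x h = r , (λ h′ → ℚP.<-irrefl refl (∈-elim h′)) , h

  <-≤-trans : ∀ x y z → x < y → y ≤ z → x < z
  <-≤-trans x y z (r , r∉x , r∈y) y≤z = r , r∉x , y≤z r r∈y

  ≤-<-trans : ∀ x y z → x ≤ y → y < z → x < z
  ≤-<-trans x y z x≤y (r , r∉y , r∈z) = r , (λ r∈x → r∉y (x≤y r r∈x)) , r∈z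

  -- Makes every rational name a point of [0,1], so that quantifiers over rational points of the
  -- interval become countable ones over ℚ.
  clamp : ℚ → ℚ
  clamp r = 0ℚ ℚ.⊔ (r ℚ.⊓ 1ℚ)

  0≤1ℚ : 0ℚ ℚ.≤ 1ℚ
  0≤1ℚ = ℚP.<⇒≤ (ℚP.positive⁻¹ 1ℚ)

  clamp-≤1 : ∀ r → clamp r ℚ.≤ 1ℚ
  clamp-≤1 r = ℚP.⊔-lub 0≤1ℚ (ℚP.p⊓q≤q r 1ℚ)

  clamp-id : ∀ {r} → 0ℚ ℚ.≤ r → r ℚ.≤ 1ℚ → clamp r ≡ r
  clamp-id 0≤r r≤1 = trans (cong (0ℚ ℚ.⊔_) (ℚP.p≤q⇒p⊓q≡p r≤1)) (ℚP.p≤q⇒p⊔q≡q 0≤r)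

  clamp𝕀 : ℚ → 𝕀
  clamp𝕀 r = mk𝕀 (fromℚ (clamp r)) (fromℚ-mono (ℚP.p≤p⊔q 0ℚ (r ℚ.⊓ 1ℚ))) (fromℚ-mono (clamp-≤1 r))

  ray-open : ∀ r → OpenIn𝕀 ｛ t ∣ r ∈ cut (val t) ｝
  ray-open r t h =
    r , 1ℚ ℚ.+ 1ℚ , ∈cut⇒< (val t) (∈-elim h) ,
    (1ℚ , (λ 1∈ → ℚP.<-irrefl refl (∈-elim (val≤1 t _ 1∈))) , ∈-intro (p<p+q 1ℚ (ℚP.positive⁻¹ 1ℚ))) ,
    λ u r<u _ → ∈-intro (<⇒∈cut (val u) r<u)

  ray-measurable : ∀ r → Meas [0,1] (λ t → r ∈ cut (val t))
  ray-measurable r = gen (ray-open r)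

  -- Lebesgue measure of order ideals and filters

  module _ (a b : ℕ → ℚ) (a≤b : ∀ n → a n ℚ.≤ b n) where
    private
      covered : ℕ → ℚ → ℚ
      covered N x = sumℚ (λ n → lengthBelow (a n) (b n) x) N

      -- The x ∈ [u , v] up to which finitely many intervals have total length
      -- at least x - u.  If z is the supremum of these x and z ∈ ]aₙ , bₙ[,
      -- then the n-th interval carries some x < z beyond z.
      Reached : ℚ → ℚ → ℚ → Set
      Reached u v x = u ℚ.≤ x × x ℚ.≤ v × (∃[ N ] x ℚ.- u ℚ.≤ covered N x)

      advance : ∀ {u v x y} n → Reached u v x → a n ℚ.≤ x → x ℚ.≤ y → y ℚ.≤ b n → y ℚ.≤ v → Reached u v y
      advance {u} {v} {x} {y} n (u≤x , _ , N , h) aₙ≤x x≤y y≤bₙ y≤v =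
        -- The first `suc n + N` intervals include the `N` already used and the n-th, which
        -- contributes all of `y - x`.
        ℚP.≤-trans u≤x x≤y , y≤v , suc n ℕ.+ N ,
        subst (ℚ._≤ covered (suc n ℕ.+ N) y)
          (solve 3 (λ u x y → (x :- u) :+ (y :- x) := y :- u) refl u x y)
          (ℚP.≤-trans
            (ℚP.+-monoˡ-≤ (y ℚ.- x)
              (ℚP.≤-trans h (sumℚ-extend (λ k → lengthBelow-nonneg (a k) (b k) x) (suc n) N)))
            (sumℚ-gain (suc n ℕ.+ N) (λ k → lengthBelow-mono (a k) (b k) x≤y)
              (lengthBelow-gain aₙ≤x y≤bₙ) (ℕP.m≤m+n (suc n) N)))
        where open +-*-Solver

    heine-borel : ∀ {u v T} → 0ℚ ℚ.≤ u → u ℚ.≤ v → v ℚ.≤ 1ℚ →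
                  (∀ t → fromℚ u ≤ val t → val t ≤ fromℚ v → t ∈ T) → Covers a b T →
                  ∃[ N ] v ℚ.- u ℚ.≤ sumℚ (λ n → b n ℚ.- a n) N
    heine-borel {u} {v} {T} 0≤u u≤v v≤1 [u,v]⊆T (_ , cov) = conclude (cov t t∈T)
      where
      reached-u : Reached u v u
      reached-u = ℚP.≤-refl , u≤v , 0 , ℚP.≤-reflexive (ℚP.+-inverseʳ u)

      z : ℝ
      z = record
        { cut       = ｛ r ∣ ∃[ x ] (Reached u v x × r ℚ.< x) ｝
        ; inhabited = let (r , h) = inhabited (fromℚ u) in r , ∈-intro (u , reached-u , ∈-elim h)
        ; bounded   = v , λ h → let (x , (_ , x≤v , _) , v<x) = ∈-elim h in
                      ℚP.<-irrefl refl (ℚP.<-≤-trans v<x x≤v)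
        ; downward  = λ r<r′ h → let (x , R , r′<x) = ∈-elim h in
                      ∈-intro (x , R , ℚP.<-trans r<r′ r′<x)
        ; rounded   = λ h → let (x , R , r<x) = ∈-elim h ; (m , r<m , m<x) = ℚP.<-dense r<x in
                      m , r<m , ∈-intro (x , R , m<x)
        }

      u≤z : fromℚ u ≤ z
      u≤z r h = ∈-intro (u , reached-u , ∈-elim h)

      z≤v : z ≤ fromℚ v
      z≤v r h = let (x , (_ , x≤v , _) , r<x) = ∈-elim h in ∈-intro (ℚP.<-≤-trans r<x x≤v)

      t : 𝕀
      t = mk𝕀 z (λ r h → u≤z r (fromℚ-mono 0≤u r h)) (λ r h → fromℚ-mono v≤1 r (z≤v r h))

      t∈T : t ∈ T
      t∈T = [u,v]⊆T t u≤z z≤v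

      conclude : (∃[ n ] (fromℚ (a n) < z × z < fromℚ (b n))) →
                 ∃[ N ] v ℚ.- u ℚ.≤ sumℚ (λ n → b n ℚ.- a n) N
      conclude (n , aₙ<z , (s , s∉z , s∈bₙ)) with ∈-elim (<⇒∈cut z aₙ<z)
      ... | (x , R@(_ , x≤v , _) , aₙ<x) with v ℚP.≤? b n
      -- The reached point `x` and `z` both lie in the n-th interval. Either `v` can be reached
      -- inside it, or its right end `b n` is reached, which puts `s < b n` below the supremum `z`,
      -- against `s∉z`.
      ...   | yes v≤bₙ =
        let (_ , _ , N , h) = advance n R (ℚP.<⇒≤ aₙ<x) x≤v v≤bₙ ℚP.≤-refl
        in N , ℚP.≤-trans h (sumℚ-mono N λ k → lengthBelow-bound v (a≤b k))
      ...   | no v≰bₙ = contradiction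
        (∈-intro (b n , advance n R (ℚP.<⇒≤ aₙ<x) x≤bₙ ℚP.≤-refl (ℚP.<⇒≤ (ℚP.≰⇒> v≰bₙ)) , ∈-elim s∈bₙ))
        s∉z
        where
        x≤bₙ : x ℚ.≤ b n
        x≤bₙ = ℚP.≤-trans (ℚP.≮⇒≥ λ s<x → s∉z (∈-intro (x , R , s<x))) (ℚP.<⇒≤ (∈-elim s∈bₙ))

  leb-negative : ∀ {T p} → p ℚ.< 0ℚ → p ∈ cut (leb T)
  leb-negative p<0 = let (r , p<r , r<0) = ℚP.<-dense p<0 in ∈-intro (r , p<r , λ _ _ _ → 0 , r<0)

  leb-lower : ∀ {u v T p} → 0ℚ ℚ.≤ u → u ℚ.≤ v → v ℚ.≤ 1ℚ →
              (∀ t → fromℚ u ≤ val t → val t ≤ fromℚ v → t ∈ T) →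
              p ℚ.< v ℚ.- u → p ∈ cut (leb T)
  leb-lower 0≤u u≤v v≤1 [u,v]⊆T p<v-u =
    let (r , p<r , r<v-u) = ℚP.<-dense p<v-u
    in ∈-intro (r , p<r , λ a b C@(a≤b , _) →
         let (N , h) = heine-borel a b a≤b 0≤u u≤v v≤1 [u,v]⊆T C
         in N , ℚP.<-≤-trans r<v-u h)

  -- If `y - x ≤ p < r`, the interval from `x - η` to `y + η`, followed by empty ones, covers `T`.
  -- With `η` half of `r - p` its length is `(y - x) + (r - p) ≤ r`, although `r` should be below
  -- every total length.
  leb-upper : ∀ {x y T p} → x ℚ.≤ y → (∀ t → t ∈ T → fromℚ x ≤ val t × val t ≤ fromℚ y) →
              p ∈ cut (leb T) → p ℚ.< y ℚ.- x
  leb-upper {x} {y} {T} {p} x≤y T⊆[x,y] h = ℚP.≰⇒> λ y-x≤p →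
    let (r , p<r , k) = ∈-elim h
        (N , r<sum)   = k (a p<r) (b p<r) (covers p<r)
    in ℚP.<-irrefl refl (ℚP.<-≤-trans r<sum (total p<r y-x≤p N))
    where
    module _ {r : ℚ} (p<r : p ℚ.< r) where
      η : ℚ
      η = ½ ℚ.* (r ℚ.- p)

      0<r-p : 0ℚ ℚ.< r ℚ.- p
      0<r-p = subst (ℚ._< r ℚ.- p) (ℚP.+-inverseʳ p) (ℚP.+-monoˡ-< (ℚ.- p) p<r)

      0<η : 0ℚ ℚ.< η
      0<η = subst (ℚ._< η) (ℚP.*-zeroʳ ½) (ℚP.*-monoʳ-<-pos ½ 0<r-p)

      a b : ℕ → ℚ
      a zero    = x ℚ.- η
      a (suc _) = 0ℚ
      b zero    = y ℚ.+ η
      b (suc _) = 0ℚ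

      x-η<x : x ℚ.- η ℚ.< x
      x-η<x = subst (x ℚ.- η ℚ.<_) (ℚP.+-identityʳ x) (ℚP.+-monoʳ-< x (ℚP.neg-antimono-< 0<η))

      covers : Covers a b T
      covers = (λ { zero    → ℚP.≤-trans (ℚP.<⇒≤ x-η<x) (ℚP.≤-trans x≤y (p≤p+q y (ℚP.<⇒≤ 0<η)))
                  ; (suc _) → ℚP.≤-refl })
             , λ t t∈T → let (x≤t , t≤y) = T⊆[x,y] t t∈T in
               0 , ∈cut⇒< (val t) (x≤t _ (∈-intro x-η<x))
                 , (y , (λ y∈t → ℚP.<-irrefl refl (∈-elim (t≤y y y∈t))) , ∈-intro (p<p+q y 0<η))

      total-suc : ∀ N → sumℚ (λ n → b n ℚ.- a n) (suc N) ≡ (y ℚ.- x) ℚ.+ (r ℚ.- p)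
      total-suc zero = solve 4
        (λ x y r p → con 0ℚ :+ ((y :+ con ½ :* (r :- p)) :- (x :- con ½ :* (r :- p))) := (y :- x) :+ (r :- p))
        refl x y r p
        where open +-*-Solver
      total-suc (suc N) = trans (ℚP.+-identityʳ _) (total-suc N)

      total : y ℚ.- x ℚ.≤ p → ∀ N → sumℚ (λ n → b n ℚ.- a n) N ℚ.≤ r
      total y-x≤p zero    = ℚP.≤-trans (0≤q-p x≤y) (ℚP.≤-trans y-x≤p (ℚP.<⇒≤ p<r))
      total y-x≤p (suc N) = subst₂ ℚ._≤_ (sym (total-suc N))
        (solve 2 (λ r p → p :+ (r :- p) := r) refl r p)
        (ℚP.+-monoˡ-≤ (r ℚ.- p) y-x≤p)
        where open +-*-Solver

  Decreasing Increasing : (𝕀 → Set) → Set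
  Decreasing T = ∀ t u → val t ≤ val u → T u → T t
  Increasing T = ∀ t u → val t ≤ val u → T t → T u

  Monotone : (𝕀 → Set) → Set
  Monotone T = Decreasing T ⊎ Increasing T

  -- For monotone `T` and `p ≥ 0` this amounts to `p < leb T`. It inspects `T` at rational points
  -- only, hence is a countable condition.
  RationalGap : (𝕀 → Set) → ℚ → Set
  RationalGap T p = ∃[ u ] ∃[ v ] (T (clamp𝕀 u) × T (clamp𝕀 v) × p ℚ.< clamp v ℚ.- clamp u)

  p<q⇒p<q-0 : ∀ {p q} → p ℚ.< q → p ℚ.< q ℚ.- 0ℚ
  p<q⇒p<q-0 {p} {q} = subst (p ℚ.<_) (sym (ℚP.+-identityʳ q))

  p<q-r⇒r<q-p : ∀ {p q r} → p ℚ.< q ℚ.- r → r ℚ.< q ℚ.- p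
  p<q-r⇒r<q-p {p} {q} {r} lt = subst₂ ℚ._<_
    (solve 2 (λ p r → p :+ (r :- p) := r) refl p r)
    (solve 3 (λ p q r → (q :- r) :+ (r :- p) := q :- p) refl p q r)
    (ℚP.+-monoˡ-< (r ℚ.- p) lt)
    where open +-*-Solver

  -- A nonempty decreasing `T` contains 0, so without a gap it lies in [0,p]; a nonempty increasing
  -- one contains 1, so it lies in [1-p,1]. Either way `leb-upper` yields `p < p`.
  leb-monotone⇒ : ∀ {T p} → Monotone (_∈ T) → p ∈ cut (leb T) → p ℚ.< 0ℚ ⊎ RationalGap (_∈ T) p
  leb-monotone⇒ {T} {p} mono h with p ℚP.<? 0ℚ
  ... | yes p<0 = inj₁ p<0
  ... | no p≮0  = inj₂ (by-contradiction λ ¬gap → ℚP.<-irrefl refl (narrow ¬gap mono))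
    where
    0≤p : 0ℚ ℚ.≤ p
    0≤p = ℚP.≮⇒≥ p≮0

    narrow : ¬ RationalGap (_∈ T) p → Monotone (_∈ T) → p ℚ.< p
    narrow ¬gap (inj₁ dec) =
      subst (p ℚ.<_) (ℚP.+-identityʳ p) (leb-upper {T = T} 0≤p (λ t t∈T → 0≤val t , below t t∈T) h)
      where
      below : ∀ t → t ∈ T → val t ≤ fromℚ p
      below t t∈T r r∈t = ∈-intro (ℚP.≰⇒> λ p≤r →
        let (r′ , r<r′ , r′∈t) = rounded (val t) r∈t
            p<r′ = ℚP.≤-<-trans p≤r r<r′
            r′≤1 = ℚP.<⇒≤ (∈-elim (val≤1 t r′ r′∈t))
            e    = clamp-id (ℚP.<⇒≤ (ℚP.≤-<-trans 0≤p p<r′)) r′≤1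
            r′∈T = dec (clamp𝕀 r′) t
                     (subst (λ q → fromℚ q ≤ val t) (sym e) (∈cut⇒fromℚ≤ (val t) r′∈t)) t∈T
        in ¬gap (0ℚ , r′ , dec (clamp𝕀 0ℚ) t (0≤val t) t∈T , r′∈T
                , p<q⇒p<q-0 (subst (p ℚ.<_) (sym e) p<r′)))
    narrow ¬gap (inj₂ inc) =
      subst (p ℚ.<_) (solve 1 (λ p → con 1ℚ :- (con 1ℚ :- p) := p) refl p)
        (leb-upper {T = T} 1-p≤1 (λ t t∈T → above t t∈T , val≤1 t) h)
      where
      open +-*-Solver
      1-p≤1 : 1ℚ ℚ.- p ℚ.≤ 1ℚ
      1-p≤1 = subst (1ℚ ℚ.- p ℚ.≤_) (ℚP.+-identityʳ 1ℚ) (ℚP.+-monoʳ-≤ 1ℚ (ℚP.neg-antimono-≤ 0≤p))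

      above : ∀ t → t ∈ T → fromℚ (1ℚ ℚ.- p) ≤ val t
      above t t∈T r r∈ = by-contradiction λ r∉t →
        let r<1-p = ∈-elim r∈
            0≤r   = ℚP.≮⇒≥ λ r<0 → r∉t (0≤val t r (∈-intro r<0))
            e     = clamp-id 0≤r (ℚP.<⇒≤ (ℚP.<-≤-trans r<1-p 1-p≤1))
            r∈T   = inc t (clamp𝕀 r)
                      (subst (λ q → val t ≤ fromℚ q) (sym e) (∉cut⇒≤fromℚ (val t) r∉t)) t∈T
        in ¬gap (r , 1ℚ , r∈T , inc t (clamp𝕀 1ℚ) (val≤1 t) t∈T
                , subst (λ q → p ℚ.< 1ℚ ℚ.- q) (sym e) (p<q-r⇒r<q-p {q = 1ℚ} r<1-p))

  -- A monotone set contains the whole interval between two of its points, so `leb-lower` applies;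
  -- for `p ≥ 0` the gap itself forces the endpoints into the right order.
  leb-monotone⇐ : ∀ {T p} → Monotone (_∈ T) → p ℚ.< 0ℚ ⊎ RationalGap (_∈ T) p → p ∈ cut (leb T)
  leb-monotone⇐ {T} mono (inj₁ p<0) = leb-negative {T} p<0
  leb-monotone⇐ {T} {p} mono (inj₂ (u , v , u∈T , v∈T , p<v-u)) with p ℚP.<? 0ℚ
  ... | yes p<0 = leb-negative {T} p<0
  ... | no p≮0  = leb-lower (0≤clamp u) u≤v (clamp-≤1 v) (convex mono) p<v-u
    where
    0≤clamp : ∀ r → 0ℚ ℚ.≤ clamp r
    0≤clamp r = ℚP.p≤p⊔q 0ℚ (r ℚ.⊓ 1ℚ)

    u≤v : clamp u ℚ.≤ clamp v
    u≤v = ℚP.≮⇒≥ λ v<u → p≮0 (ℚP.<-trans p<v-u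
      (subst (clamp v ℚ.- clamp u ℚ.<_) (ℚP.+-inverseʳ (clamp u)) (ℚP.+-monoˡ-< (ℚ.- clamp u) v<u)))

    convex : Monotone (_∈ T) → ∀ t → fromℚ (clamp u) ≤ val t → val t ≤ fromℚ (clamp v) → t ∈ T
    convex (inj₁ dec) t _ t≤v = dec t (clamp𝕀 v) t≤v v∈T
    convex (inj₂ inc) t u≤t _ = inc (clamp𝕀 u) t u≤t u∈T

  -- Measures as functions of the measure

  module _ {S T : MeasurableSpace} where
    private
      module S = MeasurableSpace S
      module T = MeasurableSpace T

    Meas-fst : {P : Carrier S → Set} → Meas S P → Meas (S ⊗ T) (λ (x , y) → P x)
    Meas-fst {P} m = gen ((｛ x ∣ P x ｝ , m) , (univ , T.whole) , λ (x , y) → sym (∧-identityʳ _))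

    Meas-snd : {P : Carrier T → Set} → Meas T P → Meas (S ⊗ T) (λ (x , y) → P y)
    Meas-snd {P} m = gen ((univ , S.whole) , (｛ y ∣ P y ｝ , m) , λ _ → refl)

    section : ∀ {H} → Measurable (S ⊗ T) H → ∀ y → Measurable S (λ x → H (x , y))
    section (gen ((A , mA) , (B , mB) , e)) y with B y in By
    ... | true  = S.resp (λ x → sym (trans (e (x , y)) (trans (cong (A x ∧_) By) (∧-identityʳ (A x))))) mA
    ... | false = S.resp (λ x → sym (trans (e (x , y)) (trans (cong (A x ∧_) By) (∧-zeroʳ (A x))))) (S.compl S.whole)
    section (resp e h)  y = S.resp (λ x → e (x , y)) (section h y)
    section whole       y = S.whole
    section (compl h)   y = S.compl (section h y)
    section (union h)   y = S.union (λ n → section (h n) y)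

  module _ {S : MeasurableSpace} where
    private module S = MeasurableSpace S

    MeasurableReal : (Carrier S → ℝ) → Set
    MeasurableReal f = ∀ r → Meas S (λ x → r ∈ cut (f x))

    MeasurableReal-sum : ∀ {f : ℕ → Carrier S → ℝ} → (∀ k → MeasurableReal (f k)) →
                         ∀ n → MeasurableReal (λ x → sum (λ k → f k x) n)
    MeasurableReal-sum m zero    r = Meas-const {S}
    MeasurableReal-sum m (suc n) r = Meas-⇔ {S} (λ _ → ∈-intro) (λ _ → ∈-elim)
      (Meas-∃ℚ {S} λ p → Meas-∃ℚ {S} λ q →
        Meas-× {S} (MeasurableReal-sum m n p) (Meas-× {S} (m n q) (Meas-const {S})))

    Meas-fromℚ< : ∀ f → MeasurableReal f → ∀ c → Meas S (λ x → fromℚ c < f x)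
    Meas-fromℚ< f m c = Meas-∃ℚ {S} λ r → Meas-× {S} (Meas-const {S}) (m r)

    -- `val t < f x` means that some rational is below `f x` but not below `val t`, so the set is a
    -- countable union of rectangles.
    Meas-subgraph : ∀ f → MeasurableReal f → Meas (S ⊗ [0,1]) (λ (x , t) → val t < f x)
    Meas-subgraph f m = Meas-∃ℚ {S ⊗ [0,1]} λ r → Meas-× {S ⊗ [0,1]}
      (Meas-snd {S} {[0,1]} (Meas-¬ {[0,1]} (ray-measurable r)))
      (Meas-fst {S} {[0,1]} (m r))

    -- `B` splits into `A`, the rest of `B` and empty sets; countable additivity bounds the first
    -- partial sum by the measure of `B`.
    μ-mono : (ν : SubProb S) (A B : ℬ S) → proj₁ A ⊆ proj₁ B → val (μ ν A) ≤ val (μ ν B)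
    μ-mono ν A B A⊆B r r∈ = proj₁ (μ-resp ν (⋃ℬ {S} C) B ⋃C≐B) r (proj₁ (additive ν C disjoint) 1 r first)
      where
      C : ℕ → ℬ S
      C zero          = A
      C (suc zero)    = _∩ℬ_ {S} B (∁ℬ {S} A)
      C (suc (suc _)) = ∁ℬ {S} (univ , S.whole)

      disjoint : Disjoint (λ n → proj₁ (C n))
      disjoint zero zero          x i≢j _ _   = i≢j refl
      disjoint zero (suc zero)    x _ x∈A x∈C = not-elim (proj₂ (∧-elim x∈C)) x∈A
      disjoint (suc zero) zero    x _ x∈C x∈A = not-elim (proj₂ (∧-elim x∈C)) x∈A
      disjoint (suc zero) (suc zero) x i≢j _ _ = i≢j refl
      disjoint i (suc (suc _)) x _ _ ()
      disjoint (suc (suc _)) j x _ () _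

      ⋃C≐B : proj₁ (⋃ℬ {S} C) ≐ proj₁ B
      ⋃C≐B x = trans (does-⇔ to from) (does-true (proj₁ B x))
        where
        to : ∃[ n ] x ∈ proj₁ (C n) → x ∈ proj₁ B
        to (zero , h)     = A⊆B x h
        to (suc zero , h) = proj₁ (∧-elim h)
        from : x ∈ proj₁ B → ∃[ n ] x ∈ proj₁ (C n)
        from h with em {x ∈ proj₁ A}
        ... | yes x∈A = 0 , x∈A
        ... | no x∉A  = 1 , ∧-intro h (not-intro x∉A)

      first : r ∈ cut (0ℝ + val (μ ν A))
      first = let (q , r<q , q∈) = rounded (val (μ ν A)) r∈ in
        ∈-intro (r ℚ.- q , q
                , ∈-intro (subst (r ℚ.- q ℚ.<_) (ℚP.+-inverseʳ q) (ℚP.+-monoˡ-< (ℚ.- q) r<q))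
                , q∈ , solve 2 (λ q r → r := (r :- q) :+ q) refl q r)
        where open +-*-Solver

    -- Measurability of both sets makes `⟪_⟫` the actual measure instead of its junk value 0.
    ⟪⟫-mono : (ν : SubProb S) {A B : 𝒫 (Carrier S)} → Measurable S A → Measurable S B → A ⊆ B →
              val (ν ⟪ A ⟫) ≤ val (ν ⟪ B ⟫)
    ⟪⟫-mono ν {A} {B} mA mB A⊆B with em {Measurable S A} | em {Measurable S B}
    ... | yes a | yes b = μ-mono ν (A , a) (B , b) A⊆B
    ... | no ¬a | _     = contradiction mA ¬a
    ... | yes _ | no ¬b = contradiction mB ¬b

  ⟪⟫-measurable : ∀ {S} A → MeasurableReal {Sub S} (λ ν → val (ν ⟪ A ⟫))
  ⟪⟫-measurable {S} A r with em {Measurable S A}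
  ... | yes m = gen ((A , m) , (｛ t ∣ r ∈ cut (val t) ｝ , ray-measurable r) , λ _ → refl)
  ... | no _  = Meas-const {Sub S}

  -- Regular families of sets and their integrals

  module _ {S : MeasurableSpace} where
    private module S = MeasurableSpace S

    Antitone Isotone : (𝕀 → 𝒫 (Carrier S)) → Set
    Antitone F = ∀ t u → val t ≤ val u → F u ⊆ F t
    Isotone  F = ∀ t u → val t ≤ val u → F t ⊆ F u

    record RegularFamily (F : 𝕀 → 𝒫 (Carrier S)) : Set where
      field
        measurable : ∀ t → Measurable S (F t)
        monotone   : Antitone F ⊎ Isotone F

    module _ {F : 𝕀 → 𝒫 (Carrier S)} (R : RegularFamily F) where
      open RegularFamily R

      Superlevel : ℚ → SubProb S → 𝒫 𝕀
      Superlevel c ν = ｛ t ∣ fromℚ c < val (ν ⟪ F t ⟫) ｝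

      Superlevel-monotone : ∀ c ν → Monotone (_∈ Superlevel c ν)
      Superlevel-monotone c ν with monotone
      ... | inj₁ anti = inj₁ λ t u t≤u h → ∈-intro
        (<-≤-trans (fromℚ c) (val (ν ⟪ F u ⟫)) (val (ν ⟪ F t ⟫)) (∈-elim h)
          (⟪⟫-mono ν (measurable u) (measurable t) (anti t u t≤u)))
      ... | inj₂ iso = inj₂ λ t u t≤u h → ∈-intro
        (<-≤-trans (fromℚ c) (val (ν ⟪ F t ⟫)) (val (ν ⟪ F u ⟫)) (∈-elim h)
          (⟪⟫-mono ν (measurable t) (measurable u) (iso t u t≤u)))

      -- The superlevel set is monotone in `t`, so its measure is decided at rational points, and at
      -- each of them `ν ⟪ F t ⟫` is measurable in `ν`.
      leb-measurable : ∀ c → MeasurableReal {Sub S} (λ ν → leb (Superlevel c ν))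
      leb-measurable c p = Meas-⇔ {Sub S}
        (λ ν → leb-monotone⇐ {Superlevel c ν} (Superlevel-monotone c ν))
        (λ ν → leb-monotone⇒ {Superlevel c ν} (Superlevel-monotone c ν))
        (Meas-⊎ {Sub S} (Meas-const {Sub S})
          (Meas-∃ℚ {Sub S} λ u → Meas-∃ℚ {Sub S} λ v →
            Meas-× {Sub S} (at-point u) (Meas-× {Sub S} (at-point v) (Meas-const {Sub S}))))
        where
        at-point : ∀ u → Meas (Sub S) (λ ν → clamp𝕀 u ∈ Superlevel c ν)
        at-point u = Meas-⇔ {Sub S} (λ _ → ∈-intro) (λ _ → ∈-elim)
          (Meas-fromℚ< {Sub S} (λ ν → val (ν ⟪ F (clamp𝕀 u) ⟫)) (⟪⟫-measurable (F (clamp𝕀 u))) c)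

      ∫-measurable : MeasurableReal {Sub S} (λ ν → ∫ (λ t → ν ⟪ F t ⟫))
      ∫-measurable r = Meas-⇔ {Sub S} (λ _ → ∈-intro) (λ _ → ∈-elim)
        (Meas-∃ {Sub S} λ m →
          MeasurableReal-sum {Sub S} (λ k → leb-measurable (+ suc k ℚ./ suc m)) (suc m)
            ((+ suc m ℚ./ 1) ℚ.* r))

    complement-regular : ∀ {F} → RegularFamily F → RegularFamily (λ t → ∁ (F t))
    complement-regular {F} R = record
      { measurable = λ t → S.compl (measurable t)
      ; monotone   = flip monotone
      }
      where
      open RegularFamily R
      flip : Antitone F ⊎ Isotone F → Antitone (λ t → ∁ (F t)) ⊎ Isotone (λ t → ∁ (F t))
      flip (inj₁ anti) = inj₂ λ t u t≤u → ∁-antitone (anti t u t≤u)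
      flip (inj₂ iso)  = inj₁ λ t u t≤u → ∁-antitone (iso t u t≤u)

    -- t-measurability is applied to the subgraph of `f` and the result is cut at `t`; upward
    -- closure gives antitonicity. With `f` an evaluation or an integral this covers `γ` and
    -- `γ ； τ`.
    effectivity-regular : ∀ {P} → IsStochasticEffectivity S P →
      ∀ (f : SubProb S → ℝ) → MeasurableReal {Sub S} f →
      RegularFamily (λ t → ｛ s ∣ P s ｛ ν ∣ val t < f ν ｝ ｝)
    effectivity-regular {P} eff f m = record
      { measurable = section {S} {[0,1]} (E.tMeasurable H (Meas-subgraph {Sub S} f m))
      ; monotone   = inj₁ λ t u t≤u s h → ∈-intro (E.upward s _ _ (∈-elim h)
          (λ ν u<f → ∈-intro (≤-<-trans (val t) (val u) (f ν) t≤u (∈-elim u<f)))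
          (section {Sub S} {[0,1]} (Meas-subgraph {Sub S} f m) t))
      }
      where
      module E = IsStochasticEffectivity eff
      H : 𝒫 (SubProb S × 𝕀)
      H = ｛ p ∣ val (proj₂ p) < f (proj₁ p) ｝

  -- Words coding sequences of rationals

  letter : List ℕ → ℕ → ℕ
  -- A default past the end of the word; `scheme` restricts itself to positions below the length.
  letter []      _       = 0
  letter (n ∷ v) zero    = n
  letter (n ∷ v) (suc k) = letter v k

  letter-applyUpTo : ∀ α {n k} → k ℕ.< n → letter (applyUpTo α n) k ≡ α k
  letter-applyUpTo α {suc n} {zero}  _ = refl
  letter-applyUpTo α {suc n} {suc k} k<n = letter-applyUpTo (λ i → α (suc i)) (ℕ.s≤s⁻¹ k<n)

  -- The conditions of `Q^∞` on the entries up to index `k`, so that a finite word decides them;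
  -- holding for all `k`, they give `Q^∞`.
  record Admissible (q : ℝ) (a : ℕ → ℚ) (k : ℕ) : Set where
    constructor admissible
    field
      nonneg  : ∀ j → j ℕ.< suc k → 0ℚ ℚ.≤ a j
      bounded : fromℚ (sumℚ a (suc k)) ≤ q

  Admissible-cong : ∀ {q a b k} → (∀ j → j ℕ.< suc k → a j ≡ b j) → Admissible q a k → Admissible q b k
  Admissible-cong {q} {k = k} e (admissible nonneg bounded) = admissible
    (λ j lt → subst (0ℚ ℚ.≤_) (e j lt) (nonneg j lt))
    (subst (λ x → fromℚ x ≤ q) (sumℚ-cong (suc k) e) bounded)

  -- The interpretation of games

  module _ {Γ : Set} {ε : Γ} (F : GameFrame Γ ε) where
    open Interpretation F
    private
      open GameFrame F renaming (space to S)
      module S = MeasurableSpace S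

    Regular : Sem → Set
    Regular K = ∀ {A} → Measurable S A → RegularFamily {S} (λ t → K A (val t))

    rational-section : ∀ {K} → Regular K → ∀ {A} → Measurable S A →
                       ∀ {a} → 0ℚ ℚ.≤ a → a ℚ.≤ 1ℚ → Measurable S (K A (fromℚ a))
    rational-section R mA {a} 0≤a a≤1 =
      RegularFamily.measurable (R mA) (mk𝕀 (fromℚ a) (fromℚ-mono 0≤a) (fromℚ-mono a≤1))

    dual-regular : ∀ {K} → Regular K → Regular (dual K)
    dual-regular R mA = complement-regular {S} (R (S.compl mA))

    -- A larger threshold admits more pairs, so the countable intersection shrinks, whatever the
    -- directions of `K` and `L`.
    angelic-regular : ∀ {K L} → Regular K → Regular L → Regular (angelic K L)
    angelic-regular {K} {L} RK RL {A} mA = record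
      { measurable = λ t → Meas-∀ℚ {S} λ a₁ → Meas-∀ℚ {S} λ a₂ → Meas-→ {S} λ (0≤a₁ , 0≤a₂ , sum≤t) →
          -- `a₁ + a₂ ≤ t ≤ 1` puts both nonnegative summands in [0,1], where `RK` and `RL` apply.
          let sum≤1 = fromℚ-cancel (λ r h → val≤1 t r (sum≤t r h)) in
          Meas-∈ {S} (Meas-∪ {S}
            (rational-section {K} RK mA 0≤a₁ (ℚP.≤-trans (p≤p+q a₁ 0≤a₂) sum≤1))
            (rational-section {L} RL mA 0≤a₂ (ℚP.≤-trans (q≤p+q a₂ 0≤a₁) sum≤1)))
      ; monotone = inj₁ λ t u t≤u s h → ∈-intro λ a₁ a₂ (0≤a₁ , 0≤a₂ , sum≤t) →
          ∈-elim h a₁ a₂ (0≤a₁ , 0≤a₂ , λ r r∈ → t≤u r (sum≤t r r∈))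
      }

    demonic-regular : ∀ {K L} → Regular K → Regular L → Regular (demonic K L)
    demonic-regular {K} {L} RK RL =
      dual-regular {angelic (dual K) (dual L)}
        (angelic-regular {dual K} {dual L} (dual-regular {K} RK) (dual-regular {L} RL))

    prim-regular : ∀ γ → Regular (𝔍-prim γ)
    prim-regular γ {A} mA = effectivity-regular {S} (P-eff γ) (λ ν → val (ν ⟪ A ⟫)) (⟪⟫-measurable {S} A)

    prim；-regular : ∀ γ {K} → Regular K → Regular (𝔍； (prim γ) K)
    prim；-regular γ {K} R {A} mA = effectivity-regular {S} (P-eff γ)
      (λ ν → ∫ (λ t → ν ⟪ K A (val t) ⟫)) (∫-measurable {S} (R mA))

    fold-regular : ∀ {f} → (∀ {K} → Regular K → Regular (f K)) →
                   ∀ {K} → Regular K → ∀ n → Regular (fold K f n)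
    fold-regular Rf R zero = R
    fold-regular {f} Rf {K} R (suc n) = Rf {fold K f n} (fold-regular {f} Rf {K} R n)

    -- Iteration by the Souslin operation, and the induction on games

    module _ (souslin : SouslinClosed S) where

      -- A state is outside `iteration` iff some sequence in `Q^∞` has it outside `K n` at every
      -- `n`. These uncountably many sequences are branches of a Souslin scheme.
      iteration-measurable : ∀ {K} → (∀ n → Regular (K n)) → ∀ {A} → Measurable S A →
                             ∀ t → Measurable S (iteration K A (val t))
      iteration-measurable {K} R {A} mA t = Meas-⇔ {S} to from
        (Meas-¬ {S} (souslin scheme scheme-measurable))
        where
        rat : List ℕ → ℕ → ℚ
        rat v k = enumℚ (letter v k)

        rat-applyUpTo : ∀ α {n} k → k ℕ.< n → rat (applyUpTo α n) k ≡ enumℚ (α k)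
        rat-applyUpTo α k k<n = cong enumℚ (letter-applyUpTo α k<n)

        Avoids : (ℕ → ℚ) → ℕ → Carrier S → Set
        Avoids a k s = Admissible (val t) a k × s ∉ K k A (fromℚ (a k))

        Avoids-cong : ∀ {a b k s} → (∀ j → j ℕ.< suc k → a j ≡ b j) → Avoids a k s → Avoids b k s
        Avoids-cong {k = k} {s} e (adm , s∉) =
          Admissible-cong e adm , subst (λ x → s ∉ K k A (fromℚ x)) (e k ℕP.≤-refl) s∉

        scheme : List ℕ → 𝒫 (Carrier S)
        scheme v = ｛ s ∣ (∀ k → k ℕ.< length v → Avoids (rat v) k s) ｝

        scheme-measurable : ∀ v → Measurable S (scheme v)
        scheme-measurable v = Meas-∀ {S} λ k → Meas-→ {S} λ _ → Meas-const× {S}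
          -- Admissibility comes first in `Avoids`: the entry `rat v k` is at most the sum, hence at
          -- most `t ≤ 1`, and so its section is measurable.
          λ (admissible nonneg sum≤t) → Meas-¬ {S} (Meas-∈ {S}
            (rational-section {K k} (R k) mA (nonneg k ℕP.≤-refl)
              (ℚP.≤-trans
                (q≤p+q (rat v k) (sumℚ-nonneg k (λ j j<k → nonneg j (ℕP.m≤n⇒m≤1+n j<k))))
                (fromℚ-cancel (λ r h → val≤1 t r (sum≤t r h))))))

        to : ∀ s → ¬ (∃[ α ] (∀ n → s ∈ scheme (applyUpTo α n))) →
             ∀ a → Q^∞ (val t) a → ∃[ n ] s ∈ K n A (fromℚ (a n))
        to s ¬branch a (0≤a , sum≤t) = by-contradiction λ ¬hit →
          -- `α` chooses a code for each entry of `a`; all its prefixes then lie in the scheme.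
          let α  = λ n → proj₁ (enumℚ-surjective (a n))
              eα = λ n → proj₂ (enumℚ-surjective (a n))
          in ¬branch (α , λ n → ∈-intro λ k k<len →
               let k<n = subst (k ℕ.<_) (length-applyUpTo α n) k<len in
               Avoids-cong
                 (λ j j≤k → sym (trans (rat-applyUpTo α j (ℕP.<-≤-trans j≤k k<n)) (eα j)))
                 (admissible (λ j _ → 0≤a j) (sum≤t (suc k)) , λ s∈ → ¬hit (k , s∈)))

        from : ∀ s → (∀ a → Q^∞ (val t) a → ∃[ n ] s ∈ K n A (fromℚ (a n))) →
               ¬ (∃[ α ] (∀ n → s ∈ scheme (applyUpTo α n)))
        from s hit (α , branch) = proj₂ (avoids (proj₁ hitₐ)) (proj₂ hitₐ)
          where
          a : ℕ → ℚ
          a n = enumℚ (α n)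

          avoids : ∀ k → Avoids a k s
          avoids k = Avoids-cong (rat-applyUpTo α)
            -- Length `suc k` is the least at which the prefix has a letter at position `k`.
            (∈-elim (branch (suc k)) k (subst (k ℕ.<_) (sym (length-applyUpTo α (suc k))) ℕP.≤-refl))

          sum≤t : ∀ n → fromℚ (sumℚ a n) ≤ val t
          sum≤t zero    = 0≤val t
          sum≤t (suc n) = Admissible.bounded (proj₁ (avoids n))

          hitₐ : ∃[ n ] s ∈ K n A (fromℚ (a n))
          hitₐ = hit a ((λ n → Admissible.nonneg (proj₁ (avoids n)) n ℕP.≤-refl) , sum≤t)

      iteration-regular : ∀ {K} → (∀ n → Regular (K n)) → Regular (iteration K)
      iteration-regular {K} R mA = record
        { measurable = iteration-measurable {K} R mA
        ; monotone   = inj₁ λ t u t≤u s h → ∈-intro λ a (0≤a , sum≤t) →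
            ∈-elim h a (0≤a , λ n r r∈ → t≤u r (sum≤t n r r∈))
        }

      -- Stated for all `K` because duals, compositions and iterations change the continuation in
      -- the recursive calls.
      𝔍；-regular : ∀ τ {K} → Regular K → Regular (𝔍； τ K)
      𝔍；-regular (prim γ)  {K} R = prim；-regular γ {K} R
      𝔍；-regular (τ ᵈ)     {K} R =
        dual-regular {𝔍； τ (dual K)} (𝔍；-regular τ {dual K} (dual-regular {K} R))
      𝔍；-regular (τ₁ ⊍ τ₂) {K} R =
        angelic-regular {𝔍； τ₁ K} {𝔍； τ₂ K} (𝔍；-regular τ₁ {K} R) (𝔍；-regular τ₂ {K} R)
      𝔍；-regular (τ₁ ⩀ τ₂) {K} R =
        demonic-regular {𝔍； τ₁ K} {𝔍； τ₂ K} (𝔍；-regular τ₁ {K} R) (𝔍；-regular τ₂ {K} R)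
      𝔍；-regular (τ₁ ； τ₂) {K} R = 𝔍；-regular τ₁ {𝔍； τ₂ K} (𝔍；-regular τ₂ {K} R)
      𝔍；-regular (τ *)     {K} R = iteration-regular {λ n → fold K (𝔍； τ) n}
        (fold-regular {𝔍； τ} (λ {L} → 𝔍；-regular τ {L}) {K} R)
      𝔍；-regular (τ ˣ)     {K} R = dual-regular {iteration (λ n → fold (dual K) step n)}
        (iteration-regular {λ n → fold (dual K) step n}
          (fold-regular {step}
            (λ {L} RL → dual-regular {𝔍； τ (dual L)} (𝔍；-regular τ {dual L} (dual-regular {L} RL)))
            {dual K} (dual-regular {K} R)))
        where
        step : Sem → Sem
        step L = dual (𝔍； τ (dual L))

      𝔍-regular : ∀ τ → Regular (𝔍 τ)
      𝔍-regular (prim γ)  = prim-regular γ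
      𝔍-regular (τ ᵈ)     = dual-regular {𝔍 τ} (𝔍-regular τ)
      𝔍-regular (τ₁ ⊍ τ₂) = angelic-regular {𝔍 τ₁} {𝔍 τ₂} (𝔍-regular τ₁) (𝔍-regular τ₂)
      𝔍-regular (τ₁ ⩀ τ₂) = demonic-regular {𝔍 τ₁} {𝔍 τ₂} (𝔍-regular τ₁) (𝔍-regular τ₂)
      𝔍-regular (τ₁ ； τ₂) = 𝔍；-regular τ₁ {𝔍 τ₂} (𝔍-regular τ₂)
      𝔍-regular (τ *)     = 𝔍；-regular (τ *) {𝔍-prim ε} (prim-regular ε)
      𝔍-regular (τ ˣ)     = dual-regular {𝔍； (τ ᵈ *) (𝔍-prim ε)}
        (𝔍；-regular (τ ᵈ *) {𝔍-prim ε} (prim-regular ε))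

  -- Measurability of validity sets

  ⟦⟧-measurable : ∀ {Γ ε Ψ} (𝒢 : GameModel Γ ε Ψ) → SouslinClosed (GameModel.space 𝒢) →
                  ∀ φ → Measurable (GameModel.space 𝒢) (⟦_⟧ 𝒢 φ)
  ⟦⟧-measurable 𝒢 souslin ⊤′       = MeasurableSpace.whole (GameModel.space 𝒢)
  ⟦⟧-measurable 𝒢 souslin (atom p) = proj₂ (GameModel.V 𝒢 p)
  ⟦⟧-measurable 𝒢 souslin (φ ∧′ ψ) = proj₂ (_∩ℬ_ {GameModel.space 𝒢}
    (⟦_⟧ 𝒢 φ , ⟦⟧-measurable 𝒢 souslin φ) (⟦_⟧ 𝒢 ψ , ⟦⟧-measurable 𝒢 souslin ψ))
  ⟦⟧-measurable 𝒢 souslin (⟨ τ ⟩[ q ] φ) = RegularFamily.measurable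
    (𝔍-regular (GameModel.frame 𝒢) souslin τ (⟦⟧-measurable 𝒢 souslin φ)) q

  -- Tests

  module _ {S : MeasurableSpace} where
    private module S = MeasurableSpace S

    -- `f` is constant, the identity or negation, so the set is everything, empty, `A` or its
    -- complement.
    measurable-of-Bool : ∀ {A} (f : Bool → Bool) → Measurable S A → Measurable S (λ s → f (A s))
    measurable-of-Bool {A} f m with f true in ft | f false in ff
    ... | true  | true  = S.resp (λ s → pointwise (A s)) S.whole
      where pointwise : ∀ b → true ≡ f b
            pointwise true  = sym ft
            pointwise false = sym ff
    ... | true  | false = S.resp (λ s → pointwise (A s)) m
      where pointwise : ∀ b → b ≡ f b
            pointwise true  = sym ft
            pointwise false = sym ff
    ... | false | true  = S.resp (λ s → pointwise (A s)) (S.compl m)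
      where pointwise : ∀ b → not b ≡ f b
            pointwise true  = sym ft
            pointwise false = sym ff
    ... | false | false = S.resp (λ s → pointwise (A s)) (S.compl S.whole)
      where pointwise : ∀ b → false ≡ f b
            pointwise true  = sym ft
            pointwise false = sym ff

    module _ (A : ℬ S) where

      -- The preimage of a generator that tests `ν(B)` tests `ν(A ∩ B)`, so it is again a generator.
      restrict-measurable : ∀ {W} → Measurable (Sub S) W → Measurable (Sub S) (λ ν → W (restrict {S} A ν))
      restrict-measurable (gen (B , E , e)) = gen (_∩ℬ_ {S} A B , E , λ ν → e (restrict {S} A ν))
      restrict-measurable (resp e m) = resp (λ ν → e (restrict {S} A ν)) (restrict-measurable m)
      restrict-measurable whole      = whole
      restrict-measurable (compl m)  = compl (restrict-measurable m)
      restrict-measurable (union m)  = union (λ n → restrict-measurable (m n))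

      restricted-δ : Carrier S → SubProb S
      restricted-δ s = restrict {S} A (δ {S} s)

      -- On a generator, the mass that `δ s` gives to `A ∩ B` is 0 or 1, so the condition is a
      -- Boolean function of membership in `A ∩ B`.
      restricted-δ-measurable : ∀ {W} → Measurable (Sub S) W → Measurable S (λ s → W (restricted-δ s))
      restricted-δ-measurable (gen (B , E , e)) = S.resp (λ s → sym (e (restricted-δ s)))
        (measurable-of-Bool (λ b → proj₁ E (if b then 1𝕀 else 0𝕀)) (proj₂ (_∩ℬ_ {S} A B)))
      restricted-δ-measurable (resp e m) = S.resp (λ s → e (restricted-δ s)) (restricted-δ-measurable m)
      restricted-δ-measurable whole      = S.whole
      restricted-δ-measurable (compl m)  = S.compl (restricted-δ-measurable m)
      restricted-δ-measurable (union m)  = S.union (λ n → restricted-δ-measurable (m n))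

      graph-measurable : ∀ {H} → Measurable (Sub S ⊗ [0,1]) H →
                         Measurable (S ⊗ [0,1]) (λ (s , q) → H (restricted-δ s , q))
      graph-measurable (gen ((W , mW) , E , e)) =
        gen (((λ s → W (restricted-δ s)) , restricted-δ-measurable mW) , E , λ (s , q) → e (restricted-δ s , q))
      graph-measurable (resp e m) = resp (λ (s , q) → e (restricted-δ s , q)) (graph-measurable m)
      graph-measurable whole      = whole
      graph-measurable (compl m)  = compl (graph-measurable m)
      graph-measurable (union m)  = union (λ n → graph-measurable (m n))

      test?-isStochasticEffectivity : IsStochasticEffectivity S (test? {S} A)
      test?-isStochasticEffectivity = record
        { measurable  = λ s W → proj₁
        ; upward      = λ s V W (_ , _ , h) V⊆W mW →
                        mW , restrict-measurable mW , V⊆W (restricted-δ s) h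
        ; tMeasurable = λ H mH → Meas-⇔ {S ⊗ [0,1]}
            -- Sections of `H` and their preimages under restriction are measurable, so the test
            -- condition reduces to `(restricted-δ s , q)` lying in `H`.
            (λ (s , q) h → let m = section {Sub S} {[0,1]} mH q in m , restrict-measurable m , h)
            (λ _ (_ , _ , h) → h)
            (Meas-∈ {S ⊗ [0,1]} (graph-measurable mH))
        }

proposition6p19 : (em : ExcludedMiddle 0ℓ) → let open Classical em in
    (Γ : Set) (ε : Γ) (Ψ : Set) (𝒢 : GameModel Γ ε Ψ) →
    let S = GameModel.space 𝒢 in
    SouslinClosed S →
    (φ : Formula Γ Ψ) →
    Σ[ m ∈ Measurable S (⟦_⟧ 𝒢 φ) ]
    ( IsStochasticEffectivity S (test? {S} (⟦_⟧ 𝒢 φ , m))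
    × IsStochasticEffectivity S (test¿ {S} (⟦_⟧ 𝒢 φ , m)) )
proposition6p19 em Γ ε Ψ 𝒢 souslin φ =
  -- `test¿` of a set is by definition `test?` of its complement.
  m , test?-isStochasticEffectivity em {S} A , test?-isStochasticEffectivity em {S} (∁ℬ {S} A)
  where
  open Classical em
  S = GameModel.space 𝒢
  m = ⟦⟧-measurable em 𝒢 souslin φ
  A = ⟦_⟧ 𝒢 φ , m
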